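{- For $n\ge 1$ let $f(n)$ denote the number of pop-stacked permutations of $[n]=\{1,\dots,n\}$. There is an algorithm which, given a positive integer $N$, computes $f(n)$ for all $1\le n\le N$ in $O(N^4)$ time using $O(N^3)$ memory, where each arithmetic operation on integers is counted as $O(1)$ time and each stored integer is counted as $O(1)$ memory.
   Context: For a permutation $\pi=a_1a_2\cdots a_n$ of $[n]$, a descending run of $\pi$ is a maximal sequence of consecutive letters $a_i>a_{i+1}>\cdots>a_{i+j}$. Factor $\pi$ into its descending runs, $\pi=D_1D_2\cdots D_m$; the pop-stack operator $P$ reverses each run: $P(\pi)=D_1^rD_2^r\cdots D_m^r$, where $D^r$ is the reversal of the word $D$. A permutation $\sigma$ of $[n]$ is pop-stacked if $\sigma=P(\pi)$ for some permutation $\pi$ of $[n]$. -}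

module Defs where

open import Data.Bool.Base using (true; false; if_then_else_)
open import Data.Fin.Base using (Fin; zero; suc; toℕ)
open import Data.Integer.Base as ℤ using (ℤ; +_; 0ℤ)
open import Data.List.Base
  using (List; []; _∷_; _++_; [_]; _∷ʳ_; map; foldr; concat; concatMap; reverse;
         length; applyUpTo; deduplicate)
open import Data.List.Membership.Propositional using (_∈_; find; lose)
open import Data.List.Membership.Propositional.Properties
  using (∈-map⁺; ∈-map⁻; ∈-concatMap⁺; ∈-concatMap⁻; ∈-∃++;
         ∈-deduplicate⁺; ∈-deduplicate⁻)
open import Data.List.NonEmpty.Base as List⁺ using (List⁺; _∷⁺_; toList)
open import Data.List.Properties using (≡-dec)
open import Data.List.Relation.Binary.Permutation.Propositional
  using (_↭_; ↭-refl; ↭-sym; ↭-trans; ↭-reflexive; prep; swap)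
open import Data.List.Relation.Binary.Permutation.Propositional.Properties
  using (shift; drop-mid; ↭-reverse; ∈-resp-↭; ++⁺; ↭-empty-inv)
open import Data.List.Relation.Unary.Any using (here; there)
open import Data.List.Relation.Unary.Unique.Propositional using (Unique)
import Data.List.Relation.Unary.Unique.DecPropositional.Properties as DecUnique
open import Data.Nat.Base using (ℕ; zero; suc; _+_; _*_; _≤_; _<ᵇ_)
open import Data.Nat.Properties using (_≟_)
open import Data.Product.Base using (_×_; _,_; ∃; ∃-syntax; proj₁; proj₂)
open import Data.Vec.Functional as Vector using (Vector)
open import Function.Base using (_∘_; const)
open import Function.Bundles using (_⇔_; mk⇔)
open import Relation.Binary.Definitions using (DecidableEquality)
open import Relation.Binary.PropositionalEquality using (_≡_; refl; sym; trans; cong; subst)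

------------------------------------------------------------------------
-- Pop-stacked permutations

[1…_] : ℕ → List ℕ
[1… n ] = applyUpTo suc n

IsPermutation : ℕ → List ℕ → Set
IsPermutation n π = π ↭ [1… n ]

consRun : ℕ → List (List⁺ ℕ) → List (List⁺ ℕ)
consRun x []       = [ List⁺.[ x ] ]
consRun x (D ∷ Ds) =
  if List⁺.head D <ᵇ x then (x ∷⁺ D) ∷ Ds else List⁺.[ x ] ∷ D ∷ Ds

descendingRuns : List ℕ → List (List⁺ ℕ)
descendingRuns = foldr consRun []

P : List ℕ → List ℕ
P π = concat (map (reverse ∘ toList) (descendingRuns π))

PopStacked : ℕ → List ℕ → Set
PopStacked n σ = IsPermutation n σ × ∃[ π ] (IsPermutation n π × σ ≡ P π)

insertions : ℕ → List ℕ → List (List ℕ)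
insertions x []       = [ [ x ] ]
insertions x (y ∷ ys) = (x ∷ y ∷ ys) ∷ map (y ∷_) (insertions x ys)

permutations : List ℕ → List (List ℕ)
permutations []       = [ [] ]
permutations (x ∷ xs) = concatMap (insertions x) (permutations xs)

_≟ʷ_ : DecidableEquality (List ℕ)
_≟ʷ_ = ≡-dec _≟_

-- A duplicate-free list of all pop-stacked permutations of [n]; see
-- `popStacked-unique` and `∈-popStacked` below.
popStacked : ℕ → List (List ℕ)
popStacked n = deduplicate _≟ʷ_ (map P (permutations [1… n ]))

f : ℕ → ℕ
f n = length (popStacked n)

------------------------------------------------------------------------
-- `popStacked n` enumerates `PopStacked n` without repetition

∈-insertions⁺ : ∀ x as bs → as ++ x ∷ bs ∈ insertions x (as ++ bs)
∈-insertions⁺ x []       []       = here refl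
∈-insertions⁺ x []       (b ∷ bs) = here refl
∈-insertions⁺ x (a ∷ as) bs       = there (∈-map⁺ (a ∷_) (∈-insertions⁺ x as bs))

∈-insertions⁻ : ∀ x ys {zs} → zs ∈ insertions x ys → zs ↭ x ∷ ys
∈-insertions⁻ x []       (here refl) = ↭-refl
∈-insertions⁻ x (y ∷ ys) (here refl) = ↭-refl
∈-insertions⁻ x (y ∷ ys) (there zs∈) with ∈-map⁻ (y ∷_) zs∈
... | ws , ws∈ , refl =
  ↭-trans (prep y (∈-insertions⁻ x ys ws∈)) (swap y x ↭-refl)

∈-permutations⁺ : ∀ ys {xs} → xs ↭ ys → xs ∈ permutations ys
∈-permutations⁺ []       p = here (↭-empty-inv p)
∈-permutations⁺ (y ∷ ys) p with ∈-∃++ (∈-resp-↭ (↭-sym p) (here refl))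
... | as , bs , refl =
  ∈-concatMap⁺ (insertions y)
    (lose (∈-permutations⁺ ys (drop-mid as [] p)) (∈-insertions⁺ y as bs))

∈-permutations⁻ : ∀ ys {xs} → xs ∈ permutations ys → xs ↭ ys
∈-permutations⁻ []       (here refl) = ↭-refl
∈-permutations⁻ (y ∷ ys) xs∈ with find (∈-concatMap⁻ (insertions y) xs∈)
... | zs , zs∈ , xs∈′ =
  ↭-trans (∈-insertions⁻ y zs xs∈′) (prep y (∈-permutations⁻ ys zs∈))

concat-consRun : ∀ x Ds →
  concat (map toList (consRun x Ds)) ≡ x ∷ concat (map toList Ds)
concat-consRun x []       = refl
concat-consRun x (D ∷ Ds) with List⁺.head D <ᵇ x
... | true  = refl
... | false = refl

concat-descendingRuns : ∀ π → concat (map toList (descendingRuns π)) ≡ π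
concat-descendingRuns []      = refl
concat-descendingRuns (x ∷ π) =
  trans (concat-consRun x (descendingRuns π)) (cong (x ∷_) (concat-descendingRuns π))

P-↭ : ∀ π → P π ↭ π
P-↭ π = ↭-trans (go (descendingRuns π)) (↭-reflexive (concat-descendingRuns π))
  where
  go : ∀ Ds → concat (map (reverse ∘ toList) Ds) ↭ concat (map toList Ds)
  go []       = ↭-refl
  go (D ∷ Ds) = ++⁺ (↭-reverse (toList D)) (go Ds)

popStacked-unique : ∀ n → Unique (popStacked n)
popStacked-unique n = DecUnique.deduplicate-! _≟ʷ_ (map P (permutations [1… n ]))

∈-popStacked : ∀ n σ → σ ∈ popStacked n ⇔ PopStacked n σ
∈-popStacked n σ = mk⇔ to from
  where
  to : σ ∈ popStacked n → PopStacked n σ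
  to σ∈ with ∈-map⁻ P (∈-deduplicate⁻ _≟ʷ_ (map P (permutations [1… n ])) σ∈)
  ... | π , π∈ , refl =
    let p = ∈-permutations⁻ [1… n ] π∈ in ↭-trans (P-↭ π) p , π , p , refl

  from : PopStacked n σ → σ ∈ popStacked n
  from (_ , π , p , refl) =
    ∈-deduplicate⁺ _≟ʷ_ (∈-map⁺ P (∈-permutations⁺ [1… n ] p))

------------------------------------------------------------------------
-- Algorithms: structured programs for a unit-cost random access machine.
--
-- The machine has k registers and m memory cells, each holding one integer
-- of arbitrary size, and a write-only output.  A program is a finite
-- text that mentions neither m nor the input; memory cells can be addressed by
-- computed values, registers only by name.  There is no integer division, so
-- unit cost cannot be exploited by packing many numbers into one integer.

data Expr (k : ℕ) : Set where
  lit           : ℤ → Expr k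
  reg           : Fin k → Expr k
  _⊕_ _⊖_ _⊗_   : Expr k → Expr k → Expr k

record Test (k : ℕ) : Set where
  constructor _≤?_
  field lhs rhs : Expr k

data Program (k : ℕ) : Set where
  skip            : Program k
  _≔_             : Fin k → Expr k → Program k
  _≔mem[_]        : Fin k → Expr k → Program k
  mem[_]≔_        : Expr k → Expr k → Program k
  output          : Expr k → Program k
  _⨾_             : Program k → Program k → Program k
  test_then_else_ : Test k → Program k → Program k → Program k
  while_loop_     : Test k → Program k → Program k

infixl 7 _⊗_
infixl 6 _⊕_ _⊖_
infix  5 _≤?_
infix  4 _≔_ _≔mem[_] mem[_]≔_
infixr 3 _⨾_

record State (k m : ℕ) : Set where
  constructor ⟨_,_,_⟩
  field
    registers : Vector ℤ k
    memory    : Vector ℤ m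
    outputs   : List ℤ

eval : ∀ {k} → Vector ℤ k → Expr k → ℤ
eval ρ (lit z)   = z
eval ρ (reg i)   = ρ i
eval ρ (d ⊕ e)   = eval ρ d ℤ.+ eval ρ e
eval ρ (d ⊖ e)   = eval ρ d ℤ.- eval ρ e
eval ρ (d ⊗ e)   = eval ρ d ℤ.* eval ρ e

Holds : ∀ {k} → Vector ℤ k → Test k → Set
Holds ρ (d ≤? e) = eval ρ d ℤ.≤ eval ρ e

Fails : ∀ {k} → Vector ℤ k → Test k → Set
Fails ρ (d ≤? e) = eval ρ e ℤ.< eval ρ d

-- Each literal, register access and arithmetic operation costs 1.
cost : ∀ {k} → Expr k → ℕ
cost (lit z)   = 1
cost (reg i)   = 1
cost (d ⊕ e)   = suc (cost d + cost e)
cost (d ⊖ e)   = suc (cost d + cost e)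
cost (d ⊗ e)   = suc (cost d + cost e)

testCost : ∀ {k} → Test k → ℕ
testCost (d ≤? e) = suc (cost d + cost e)

_[_↦_] : ∀ {n} → Vector ℤ n → Fin n → ℤ → Vector ℤ n
v [ i ↦ z ] = Vector.updateAt v i (const z)

-- s ⊢ p ⇓ s′ [ t ]: started in s, the program p halts in s′ after t steps.
-- An access outside the m available memory cells has no rule, so such a
-- computation does not halt in any state.
infix 2 _⊢_⇓_[_]

data _⊢_⇓_[_] {k m : ℕ} : State k m → Program k → State k m → ℕ → Set where

  ⇓skip : ∀ {s} → s ⊢ skip ⇓ s [ 1 ]

  ⇓assign : ∀ {ρ μ o r e} →
    ⟨ ρ , μ , o ⟩ ⊢ r ≔ e ⇓ ⟨ ρ [ r ↦ eval ρ e ] , μ , o ⟩ [ suc (cost e) ]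

  ⇓load : ∀ {ρ μ o r e} (a : Fin m) → eval ρ e ≡ + toℕ a →
    ⟨ ρ , μ , o ⟩ ⊢ r ≔mem[ e ] ⇓ ⟨ ρ [ r ↦ μ a ] , μ , o ⟩ [ suc (cost e) ]

  ⇓store : ∀ {ρ μ o d e} (a : Fin m) → eval ρ d ≡ + toℕ a →
    ⟨ ρ , μ , o ⟩ ⊢ mem[ d ]≔ e ⇓ ⟨ ρ , μ [ a ↦ eval ρ e ] , o ⟩
      [ suc (cost d + cost e) ]

  ⇓output : ∀ {ρ μ o e} →
    ⟨ ρ , μ , o ⟩ ⊢ output e ⇓ ⟨ ρ , μ , o ∷ʳ eval ρ e ⟩ [ suc (cost e) ]

  ⇓seq : ∀ {s s′ s″ p q t u} →
    s ⊢ p ⇓ s′ [ t ] → s′ ⊢ q ⇓ s″ [ u ] → s ⊢ p ⨾ q ⇓ s″ [ t + u ]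

  ⇓then : ∀ {s s′ b p q t} → Holds (State.registers s) b →
    s ⊢ p ⇓ s′ [ t ] → s ⊢ test b then p else q ⇓ s′ [ testCost b + t ]

  ⇓else : ∀ {s s′ b p q t} → Fails (State.registers s) b →
    s ⊢ q ⇓ s′ [ t ] → s ⊢ test b then p else q ⇓ s′ [ testCost b + t ]

  ⇓stop : ∀ {s b p} → Fails (State.registers s) b →
    s ⊢ while b loop p ⇓ s [ testCost b ]

  ⇓loop : ∀ {s s′ s″ b p t u} → Holds (State.registers s) b →
    s ⊢ p ⇓ s′ [ t ] → s′ ⊢ while b loop p ⇓ s″ [ u ] →
    s ⊢ while b loop p ⇓ s″ [ testCost b + (t + u) ]

-- The input is placed in register 0; all other registers and all memory
-- cells start at 0.
initial : ∀ {k} m → ℕ → State (suc k) m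
initial {k} m N = ⟨ + N Vector.∷ Vector.replicate k 0ℤ , Vector.replicate m 0ℤ , [] ⟩

-- On input N, p writes exactly the list zs, halting after t steps on a machine
-- with c integer cells in total (registers and memory).
record Run {k : ℕ} (p : Program (suc k)) (N : ℕ) (zs : List ℤ) (t c : ℕ) : Set where
  field
    memorySize  : ℕ
    final       : State (suc k) memorySize
    computation : initial memorySize N ⊢ p ⇓ final [ t ]
    result      : State.outputs final ≡ zs
    cells       : c ≡ suc k + memorySize

_∈O_ : (ℕ → ℕ) → (ℕ → ℕ) → Set
g ∈O h = ∃[ C ] ∃[ n₀ ] (∀ n → n₀ ≤ n → g n ≤ C * h n)

{-# OPTIONS --safe #-}

-- A word is an image of the pop-stack operator iff, for any two adjacent maximal ascending
-- runs R R′ of it, min R < max R′.  Read such a word from left to right.  All that matters for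
-- its continuations is the first letter b of the current run, its last letter l, and the first
-- letter a of the run before it, which has to be exceeded before the current run may end.  These
-- letters cut the sorted list of unused letters into at most four intervals, and the number of
-- continuations depends only on the interval lengths.  Finding the next letter by scanning an
-- interval upwards (take the least candidate, or skip it and move it to the interval below)
-- gives a recurrence with O(1) terms over quadruples of lengths.  A quadruple is determined by
-- its sum and three entries, and sum r only refers to sums r - 1 and r; so it is enough to keep
-- the values for two consecutive sums, O(N³) of them, at any time.

module Submission where

open import Defs
open import Data.Bool.Base as Bool using (true; false)
open import Data.Empty using (⊥)
open import Data.Fin.Base using (Fin; zero; suc; toℕ; fromℕ<; combine; opposite; _↑ˡ_; _↑ʳ_)
open import Data.Fin.Patterns
import Data.Fin.Properties as Fin
open import Data.Integer.Base as ℤ using (ℤ; +_; 0ℤ)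
import Data.Integer.Properties as ℤ
open import Data.List.Base
  using (List; []; _∷_; [_]; _++_; _∷ʳ_; map; foldl; concat; reverse; length)
open import Data.List.Membership.Propositional using (_∈_; _∉_)
open import Data.List.Membership.Propositional.Properties
  using (∈-map⁺; ∈-map⁻; ∈-++⁺ˡ; ∈-++⁺ʳ; ∈-++⁻)
open import Data.List.Membership.Propositional.Properties.WithK using (unique∧set⇒bag)
open import Data.List.NonEmpty.Base as List⁺ using (List⁺; toList)
open import Data.List.Properties
  using (++-assoc; ++-identityʳ; unfold-reverse; length-++; length-map; length-applyUpTo;
         ∷-injectiveʳ; ∷ʳ-++; map-++; applyUpTo-∷ʳ)
open import Data.List.Relation.Binary.BagAndSetEquality using (∼bag⇒↭)
open import Data.List.Relation.Binary.Permutation.Propositional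
  using (_↭_; prep; ↭-trans; ↭-sym; ↭-reflexive)
open import Data.List.Relation.Binary.Permutation.Propositional.Properties
  using (↭-length; shift; drop-∷; ∈-resp-↭; ↭-empty-inv; ¬x∷xs↭[])
open import Data.List.Relation.Unary.All as All using (All; []; _∷_)
import Data.List.Relation.Unary.All.Properties as All
open import Data.List.Relation.Unary.AllPairs using (AllPairs; []; _∷_)
import Data.List.Relation.Unary.AllPairs.Properties as AllPairs
open import Data.List.Relation.Unary.Any using (here; there)
open import Data.List.Relation.Unary.Linked using (Linked; []; [-]; _∷_)
open import Data.List.Relation.Unary.Unique.Propositional using (Unique)
import Data.List.Relation.Unary.Unique.Propositional.Properties as Unique
open import Data.Nat.Base
open import Data.Nat.Properties hiding (_≤?_)
open import Data.Nat.Tactic.RingSolver using (solve-∀)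
open import Data.Product.Base using (Σ-syntax; ∃-syntax; _×_; _,_; proj₁)
open import Data.Sum.Base using (_⊎_; inj₁; inj₂; [_,_]′)
open import Data.Vec.Functional using (Vector)
import Data.Vec.Functional.Properties as Vector
open import Function.Base using (_∘_; id; const; case_of_)
open import Function.Bundles using (_⇔_; mk⇔; Equivalence)
open import Function.Construct.Composition using (_⇔-∘_)
open import Function.Construct.Symmetry using (⇔-sym)
open import Relation.Binary.PropositionalEquality hiding ([_])
open import Relation.Nullary using (¬_; yes; no; contradiction)

-- Images of the pop-stack operator

-- Overlapping a b l w: the word w may follow a letter l that lies in an ascending run with first
-- letter b, where a is the first letter of the run before; the run may end only once a ≤ l.
data Overlapping : ℕ → ℕ → ℕ → List ℕ → Set where
  stop    : ∀ {a b l} → a ≤ l → Overlapping a b l []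
  ascend  : ∀ {a b l y w} → l < y → Overlapping a b y w → Overlapping a b l (y ∷ w)
  descend : ∀ {a b l y w} → y ≤ l → a ≤ l → Overlapping b y y w → Overlapping a b l (y ∷ w)

last⁺ : ℕ → List ℕ → ℕ
last⁺ x []       = x
last⁺ x (y ∷ ys) = last⁺ y ys

Descending : ℕ → List ℕ → Set
Descending x xs = Linked _>_ (x ∷ xs)

-- Two adjacent descending runs are maximal when the last letter of the first one does not exceed
-- the first letter of the second one; p is the last letter of the run before.
data RunsAfter (p : ℕ) : List (List⁺ ℕ) → Set where
  []  : RunsAfter p []
  run : ∀ {x xs Ds} → p ≤ x → Descending x xs → RunsAfter (last⁺ x xs) Ds →
        RunsAfter p ((x List⁺.∷ xs) ∷ Ds)

reversals : List (List⁺ ℕ) → List ℕ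
reversals = concat ∘ map (reverse ∘ toList)

last⁺≤head : ∀ {x xs} → Descending x xs → last⁺ x xs ≤ x
last⁺≤head {xs = []}     _         = ≤-refl
last⁺≤head {xs = y ∷ ys} (x>y ∷ D) = ≤-trans (last⁺≤head D) (<⇒≤ x>y)

consRun-runs : ∀ x {Ds} → RunsAfter 0 Ds → RunsAfter 0 (consRun x Ds)
consRun-runs x [] = run z≤n [-] []
consRun-runs x (run {y} _ d rs) with y <ᵇ x in eq
... | true  = run z≤n (<ᵇ⇒< y x (subst Bool.T (sym eq) _) ∷ d) rs
... | false = run z≤n [-] (run (≮⇒≥ λ y<x → subst Bool.T eq (<⇒<ᵇ y<x)) d rs)

-- The bound 0 makes the condition at the left end vacuous: there is no junction before the first
-- run.
descendingRuns-runs : ∀ π → RunsAfter 0 (descendingRuns π)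
descendingRuns-runs []      = []
descendingRuns-runs (x ∷ π) = consRun-runs x (descendingRuns-runs π)

-- Rebuilding from the right, `consRun` joins a letter to the word it came from and separates it at
-- every junction, because no junction descends.
descendingRuns-concat : ∀ {p Ds} → RunsAfter p Ds → descendingRuns (concat (map toList Ds)) ≡ Ds
descendingRuns-concat [] = refl
descendingRuns-concat (run {Ds = Ds} _ d rs) = go d rs
  where
  go : ∀ {x xs} → Descending x xs → RunsAfter (last⁺ x xs) Ds →
       descendingRuns (x ∷ xs ++ concat (map toList Ds)) ≡ (x List⁺.∷ xs) ∷ Ds
  go {x} {[]} _ rs rewrite descendingRuns-concat rs with rs
  ... | [] = refl
  ... | run {y} x≤y _ _ with y <ᵇ x in eq
  ...   | true  = contradiction (<ᵇ⇒< y x (subst Bool.T (sym eq) _)) (≤⇒≯ x≤y)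
  ...   | false = refl
  go {x} {y ∷ ys} (x>y ∷ d) rs rewrite go d rs with y <ᵇ x in eq
  ... | true  = refl
  ... | false = contradiction (<⇒<ᵇ x>y) (subst Bool.T eq)

reverse-∷-++ : ∀ (x : ℕ) xs ys → reverse (x ∷ xs) ++ ys ≡ reverse xs ++ x ∷ ys
reverse-∷-++ x xs ys = begin
  reverse (x ∷ xs) ++ ys        ≡⟨ cong (_++ ys) (unfold-reverse x xs) ⟩
  (reverse xs ++ x ∷ []) ++ ys  ≡⟨ ++-assoc (reverse xs) (x ∷ []) ys ⟩
  reverse xs ++ x ∷ ys          ∎
  where open ≡-Reasoning

-- A reversed run is read upwards: `enter` accounts for its first letter, every later letter is an
-- `ascend`. `Q` is left open because the first letter may prolong the current ascending run, end
-- it, or open the word.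
overlapping-reverse : ∀ {a b x xs w} (Q : List ℕ → Set) → Descending x xs →
  (∀ {v} → Overlapping a b (last⁺ x xs) v → Q (last⁺ x xs ∷ v)) →
  Overlapping a b x w → Q (reverse (x ∷ xs) ++ w)
overlapping-reverse {xs = []} Q _ enter o = enter o
overlapping-reverse {x = x} {xs = y ∷ ys} {w} Q (x>y ∷ d) enter o =
  subst Q (sym (reverse-∷-++ x (y ∷ ys) w)) (overlapping-reverse Q d enter (ascend x>y o))

-- One ascending run of the image may pass through several reversed descending runs, so its first
-- letter only satisfies `b ≤ p`. If the next reversed run starts above `l`, the ascending run goes
-- on. Otherwise it ends, and maximality gives `b ≤ p ≤ x`, where `x` is the last letter of that
-- next reversed run.
overlapping-reversals : ∀ {a b l p Ds} → RunsAfter p Ds → a ≤ l → b ≤ p → p ≤ l →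
  Overlapping a b l (reversals Ds)
overlapping-reversals [] a≤l _ _ = stop a≤l
overlapping-reversals {a} {b} {l} (run {x} {xs} p≤x d rs) a≤l b≤p p≤l with l <? last⁺ x xs
... | yes l<e = overlapping-reverse (Overlapping a b l) d (ascend l<e)
      (overlapping-reversals rs (≤-trans a≤l (<⇒≤ (≤-trans l<e (last⁺≤head d))))
        (≤-trans (≤-trans b≤p p≤l) (<⇒≤ l<e)) (last⁺≤head d))
... | no l≮e = overlapping-reverse (Overlapping a b l) d (descend (≮⇒≥ l≮e) a≤l)
      (overlapping-reversals rs (≤-trans b≤p p≤x) ≤-refl (last⁺≤head d))

-- Reversing the ascending runs gives a preimage. The list `l ∷ ds` is the current run read
-- backwards, and `p` is the last letter of the descending run before it; `p ≤ a ≤ l` is the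
-- maximality needed at their junction.
overlapping⇒runs : ∀ {a b l w} → Overlapping a b l w → ∀ ds {p} → Descending l ds →
  last⁺ l ds ≡ b → p ≤ a →
  ∃[ Ds ] RunsAfter p Ds × reversals Ds ≡ reverse (l ∷ ds) ++ w
overlapping⇒runs {l = l} (stop a≤l) ds d _ p≤a =
  _ , run (≤-trans p≤a a≤l) d [] , refl
overlapping⇒runs {l = l} {w = y ∷ w} (ascend l<y o) ds d refl p≤a
  with Ds , rs , eq ← overlapping⇒runs o (l ∷ ds) (l<y ∷ d) refl p≤a =
  Ds , rs , trans eq (reverse-∷-++ y (l ∷ ds) w)
overlapping⇒runs {l = l} (descend y≤l a≤l o) ds d refl p≤a
  with Ds , rs , eq ← overlapping⇒runs o [] [-] refl ≤-refl =
  (l List⁺.∷ ds) ∷ Ds , run (≤-trans p≤a a≤l) d rs , cong (reverse (l ∷ ds) ++_) eq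

-- The first run of a word has no run before it to overlap with, hence the 0.
data Overlapping₁ : List ℕ → Set where
  start : ∀ {y w} → Overlapping 0 y y w → Overlapping₁ (y ∷ w)

P-overlapping : ∀ x π → Overlapping₁ (P (x ∷ π))
P-overlapping x π
  -- The third scrutinee excludes an empty list of runs, whose concatenation could not be `x ∷ π`.
  with descendingRuns (x ∷ π) | descendingRuns-runs (x ∷ π) | concat-descendingRuns (x ∷ π)
... | _ | run _ d rs | _ =
  overlapping-reverse Overlapping₁ d start
    (overlapping-reversals rs z≤n ≤-refl (last⁺≤head d))

overlapping-P : ∀ {σ} → Overlapping₁ σ → ∃[ π ] σ ≡ P π
overlapping-P (start o) with Ds , rs , eq ← overlapping⇒runs o [] [-] refl z≤n =
  concat (map toList Ds) , trans (sym eq) (cong reversals (sym (descendingRuns-concat rs)))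

-- The recurrence

record Enumeration (Q : List ℕ → Set) (n : ℕ) : Set where
  field
    words    : List (List ℕ)
    unique   : Unique words
    complete : ∀ w → w ∈ words ⇔ Q w
    size     : length words ≡ n

open Enumeration

-- Duplicate-free lists with the same members are permutations of one another.
enumeration-size : ∀ {Q m n} → Enumeration Q m → Enumeration Q n → m ≡ n
enumeration-size A B = trans (sym (size A)) (trans (↭-length A↭B) (size B))
  where
  A↭B : words A ↭ words B
  A↭B = ∼bag⇒↭ (unique∧set⇒bag (unique A) (unique B)
    λ {w} → ⇔-sym (complete B w) ⇔-∘ complete A w)

enumeration-⇔ : ∀ {Q R n} → (∀ w → Q w ⇔ R w) → Enumeration Q n → Enumeration R n
enumeration-⇔ Q⇔R A = record
  { words = words A ; unique = unique A ; size = size A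
  ; complete = λ w → Q⇔R w ⇔-∘ complete A w }

resize : ∀ {Q m n} → m ≡ n → Enumeration Q m → Enumeration Q n
resize m≡n A = record
  { words = words A ; unique = unique A ; size = trans (size A) m≡n ; complete = complete A }

enumeration-∅ : ∀ {Q} → (∀ w → ¬ Q w) → Enumeration Q 0
enumeration-∅ ¬Q = record
  { words = [] ; unique = [] ; size = refl
  ; complete = λ w → mk⇔ (λ ()) (λ q → contradiction q (¬Q w)) }

enumeration-[] : Enumeration (_≡ []) 1
enumeration-[] = record
  { words = [ [] ] ; unique = [] ∷ [] ; size = refl
  ; complete = λ w → mk⇔ (λ { (here w≡[]) → w≡[] ; (there ()) }) here }

enumeration-⊎ : ∀ {Q R m n} → (∀ w → Q w → ¬ R w) → Enumeration Q m → Enumeration R n →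
                Enumeration (λ w → Q w ⊎ R w) (m + n)
enumeration-⊎ Q∦R A B = record
  { words    = words A ++ words B
  ; unique   = Unique.++⁺ (unique A) (unique B)
      λ {w} (w∈A , w∈B) → Q∦R w (to (complete A w) w∈A) (to (complete B w) w∈B)
  ; complete = λ w → mk⇔
      ([ inj₁ ∘ to (complete A w) , inj₂ ∘ to (complete B w) ]′ ∘ ∈-++⁻ (words A))
      [ ∈-++⁺ˡ ∘ from (complete A w) , ∈-++⁺ʳ (words A) ∘ from (complete B w) ]′
  ; size     = trans (length-++ (words A)) (cong₂ _+_ (size A) (size B))
  } where open Equivalence

enumeration-∷ : ∀ {Q n} y → Enumeration Q n → Enumeration (λ w → ∃[ v ] w ≡ y ∷ v × Q v) n
enumeration-∷ y A = record
  { words    = map (y ∷_) (words A)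
  ; unique   = Unique.map⁺ ∷-injectiveʳ (unique A)
  ; complete = λ w → mk⇔
      (λ w∈ → let v , v∈ , eq = ∈-map⁻ (y ∷_) w∈ in v , eq , to (complete A v) v∈)
      (λ { (v , refl , q) → ∈-map⁺ (y ∷_) (from (complete A v) q) })
  ; size     = trans (length-map (y ∷_) (words A)) (size A)
  } where open Equivalence

-- The words that use up the letters R and begin with one of H; S is the condition for the empty
-- word to be admitted.
data Next (S : Set) (Q : ℕ → List ℕ → Set) (H R : List ℕ) : List ℕ → Set where
  done : S → Next S Q H R []
  next : ∀ {y v} → y ∈ H → Q y v → y ∷ v ↭ R → Next S Q H R (y ∷ v)

-- One scanning step: the word begins with `y` or with another candidate, and `y ∉ H` keeps the two
-- cases apart.
next-∷ : ∀ {S Q y H R R′ m n} → R ↭ y ∷ R′ → y ∉ H →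
         Enumeration (λ v → Q y v × v ↭ R′) m → Enumeration (Next S Q H R) n →
         Enumeration (Next S Q (y ∷ H) R) (m + n)
next-∷ {S} {Q} {y} {H} {R} {R′} p y∉H A B =
  enumeration-⇔ (λ w → mk⇔ to from)
    (enumeration-⊎ (λ { _ (_ , refl , _) (next y∈H _ _) → y∉H y∈H }) (enumeration-∷ y A) B)
  where
  to : ∀ {w} → (∃[ v ] w ≡ y ∷ v × Q y v × v ↭ R′) ⊎ Next S Q H R w → Next S Q (y ∷ H) R w
  to (inj₁ (_ , refl , q , v↭)) = next (here refl) q (↭-trans (prep y v↭) (↭-sym p))
  to (inj₂ (done s))            = done s
  to (inj₂ (next z∈H q z∷v↭))   = next (there z∈H) q z∷v↭
  from : ∀ {w} → Next S Q (y ∷ H) R w → (∃[ v ] w ≡ y ∷ v × Q y v × v ↭ R′) ⊎ Next S Q H R w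
  from (done s)                       = inj₂ (done s)
  from (next (here refl) q y∷v↭)      = inj₁ (_ , refl , q , drop-∷ (↭-trans y∷v↭ p))
  from (next (there z∈H) q z∷v↭)      = inj₂ (next z∈H q z∷v↭)

next-∅ : ∀ {S Q R} → ¬ S → Enumeration (Next S Q [] R) 0
next-∅ ¬s = enumeration-∅ λ { _ (done s) → ¬s s }

-- While `l < a` the run may not end, so `stop` and `descend` are excluded and the next letter comes
-- from above `l`.
rest-unsatisfied : ∀ {a b l L H n} → All (_< l) L → All (l <_) H → l < a →
  Enumeration (Next ⊥ (Overlapping a b) H (L ++ H)) n →
  Enumeration (λ v → Overlapping a b l v × v ↭ L ++ H) n
rest-unsatisfied {a} {b} {l} {L} {H} L<l l<H l<a = enumeration-⇔ (λ v → mk⇔ to from)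
  where
  to : ∀ {v} → Next ⊥ (Overlapping a b) H (L ++ H) v → Overlapping a b l v × v ↭ L ++ H
  to (next y∈H o p) = ascend (All.lookup l<H y∈H) o , p
  from : ∀ {v} → Overlapping a b l v × v ↭ L ++ H → Next ⊥ (Overlapping a b) H (L ++ H) v
  from (stop a≤l        , _) = contradiction a≤l (<⇒≱ l<a)
  from (descend _ a≤l _ , _) = contradiction a≤l (<⇒≱ l<a)
  from (ascend l<y o    , p) with ∈-++⁻ L (∈-resp-↭ p (here refl))
  ... | inj₁ y∈L = contradiction l<y (<-asym (All.lookup L<l y∈L))
  ... | inj₂ y∈H = next y∈H o p

-- Once `a ≤ l`, a next letter below `l` opens a new run and one above `l` prolongs the current run.
-- The empty word is counted with the first kind only, so the union is disjoint.
rest-satisfied : ∀ {a b l L H m n} → All (_< l) L → All (l <_) H → a ≤ l →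
  Enumeration (Next (L ++ H ≡ []) (λ y → Overlapping b y y) L (L ++ H)) m →
  Enumeration (Next ⊥ (Overlapping a b) H (L ++ H)) n →
  Enumeration (λ v → Overlapping a b l v × v ↭ L ++ H) (m + n)
rest-satisfied {a} {b} {l} {L} {H} L<l l<H a≤l A B =
  enumeration-⇔ (λ v → mk⇔ to from) (enumeration-⊎ disjoint A B)
  where
  Stop Go : List ℕ → Set
  Stop = Next (L ++ H ≡ []) (λ y → Overlapping b y y) L (L ++ H)
  Go   = Next ⊥ (Overlapping a b) H (L ++ H)
  disjoint : ∀ v → Stop v → ¬ Go v
  disjoint _ (next y∈L _ _) (next y∈H _ _) = <-asym (All.lookup L<l y∈L) (All.lookup l<H y∈H)
  to : ∀ {v} → Stop v ⊎ Go v → Overlapping a b l v × v ↭ L ++ H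
  to (inj₁ (done e))       = stop a≤l , ↭-reflexive (sym e)
  to (inj₁ (next y∈L o p)) = descend (<⇒≤ (All.lookup L<l y∈L)) a≤l o , p
  to (inj₂ (next y∈H o p)) = ascend (All.lookup l<H y∈H) o , p
  from : ∀ {v} → Overlapping a b l v × v ↭ L ++ H → Stop v ⊎ Go v
  from (stop _ , p) = inj₁ (done (↭-empty-inv (↭-sym p)))
  from (ascend l<y o , p) with ∈-++⁻ L (∈-resp-↭ p (here refl))
  ... | inj₁ y∈L = contradiction l<y (<-asym (All.lookup L<l y∈L))
  ... | inj₂ y∈H = inj₂ (next y∈H o p)
  from (descend y≤l _ o , p) with ∈-++⁻ L (∈-resp-↭ p (here refl))
  ... | inj₁ y∈L = inj₁ (next y∈L o p)
  ... | inj₂ y∈H = contradiction y≤l (<⇒≱ (All.lookup l<H y∈H))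

Sorted : List ℕ → Set
Sorted = AllPairs _<_

sorted-below : ∀ L {y H} → Sorted (L ++ y ∷ H) → All (_< y) L
sorted-below []      _        = []
sorted-below (x ∷ L) (xs ∷ s) = All.head (All.++⁻ʳ L xs) ∷ sorted-below L s

sorted-above : ∀ L {y H} → Sorted (L ++ y ∷ H) → All (y <_) H
sorted-above []      (ys ∷ _) = ys
sorted-above (x ∷ L) (_ ∷ s)  = sorted-above L s

sorted-delete : ∀ L {y H} → Sorted (L ++ y ∷ H) → Sorted (L ++ H)
sorted-delete []      (_ ∷ s)  = s
sorted-delete (x ∷ L) (xs ∷ s) =
  All.++⁺ (All.++⁻ˡ L xs) (All.tail (All.++⁻ʳ L xs)) ∷ sorted-delete L s

length-delete : ∀ L {y : ℕ} {H r} → length (L ++ y ∷ H) ≡ suc r → length (L ++ H) ≡ r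
length-delete L {y} {H} eq = suc-injective (trans (sym (↭-length (shift y L H))) eq)

>⇒∉ : ∀ {y H} → All (y <_) H → y ∉ H
>⇒∉ y<H y∈H = <-irrefl refl (All.lookup y<H y∈H)

-- Both functions count continuations when r letters are unused.  In rise r a b c the current run
-- has to be continued: a unused letters are below its first letter, c are candidates that do not
-- exceed the first letter of the previous run, b are candidates that do.  In turn r a b c the
-- current run ends here: the candidates are the a unused letters below its first letter and the b
-- between its first and its last letter, and c more are above its last letter.  The remaining
-- unused letters are not candidates; there are r minus a + b + c of them.
rise turn : ℕ → ℕ → ℕ → ℕ → ℕ
rise zero    a b       c       = 0
rise (suc r) a b       (suc c) = rise r a b c + rise (suc r) a b c
rise (suc r) a (suc b) zero    = turn r a (r ∸ (a + b)) b + rise r a b 0 + rise (suc r) a b 0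
rise (suc r) a zero    zero    = 0
turn zero    a       b       c = 1
turn (suc r) (suc a) b       c = rise r (r ∸ (a + (b + c))) (b + c) a + turn (suc r) a b c
turn (suc r) zero    (suc b) c =
  turn r (r ∸ (b + c)) 0 (b + c) + rise r (r ∸ (b + c)) (b + c) 0 + turn (suc r) 0 b c
turn (suc r) zero    zero    c = 0

∷ʳ-assoc : ∀ (I J : List ℕ) y H → (I ++ J) ++ y ∷ H ≡ (I ++ (J ∷ʳ y)) ++ H
∷ʳ-assoc I J y H = trans (sym (∷ʳ-++ (I ++ J) y H)) (cong (_++ H) (++-assoc I J [ y ]))

m∸n≡o : ∀ {m n o} → o + n ≡ m → m ∸ n ≡ o
m∸n≡o {n = n} {o} refl = m+n∸n≡m o n

next-done : ∀ {Q H R} → length R ≡ 0 → Enumeration (Next (R ≡ []) Q H R) 1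
next-done {R = []} _ = enumeration-⇔
  (λ w → mk⇔ (λ { refl → done refl })
             (λ { (done _) → refl ; (next _ _ p) → contradiction p ¬x∷xs↭[] }))
  enumeration-[]

next-stuck : ∀ {Q H R} → length R ≡ 0 → Enumeration (Next ⊥ Q H R) 0
next-stuck {R = []} _ = enumeration-∅ λ { _ (next _ _ p) → ¬x∷xs↭[] p }

length-++₄ : ∀ (X I J K : List ℕ) {r} → length (X ++ I ++ J ++ K) ≡ r →
             length X + (length I + (length J + length K)) ≡ r
length-++₄ X I J K len = begin
  length X + (length I + (length J + length K))  ≡⟨ cong (λ n → length X + (length I + n)) (length-++ J) ⟨
  length X + (length I + length (J ++ K))        ≡⟨ cong (_+_ (length X)) (length-++ I) ⟨
  length X + length (I ++ J ++ K)                ≡⟨ length-++ X ⟨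
  length (X ++ I ++ J ++ K)                      ≡⟨ len ⟩
  _                                              ∎
  where open ≡-Reasoning

mutual
  enumeration-rise : ∀ r {a b} I J K M {R} → R ≡ (I ++ J) ++ K ++ M → Sorted R → length R ≡ r →
    All (_< b) I → All (b ≤_) J → All (b ≤_) K → All (b ≤_) M → All (_< a) K → All (a ≤_) M →
    Enumeration (Next ⊥ (Overlapping a b) (K ++ M) R) (rise r (length I) (length M) (length K))
  enumeration-rise zero I J K M _ _ len _ _ _ _ _ _ = next-stuck len
  enumeration-rise (suc r) I J (y ∷ K) M refl s len I<b b≤J (b≤y ∷ b≤K) b≤M (y<a ∷ K<a) a≤M =
    next-∷ (shift y (I ++ J) (K ++ M)) (>⇒∉ y<H)
      (rest-unsatisfied (sorted-below (I ++ J) s) y<H y<a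
        (enumeration-rise r I J K M refl (sorted-delete (I ++ J) s) (length-delete (I ++ J) len)
          I<b b≤J b≤K b≤M K<a a≤M))
      (enumeration-rise (suc r) I (J ∷ʳ y) K M (∷ʳ-assoc I J y (K ++ M)) s len
        I<b (All.∷ʳ⁺ b≤J b≤y) b≤K b≤M K<a a≤M)
    where y<H = sorted-above (I ++ J) s
  enumeration-rise (suc r) {a} {b} I J [] (y ∷ M) refl s len I<b b≤J [] (b≤y ∷ b≤M) [] (a≤y ∷ a≤M) =
    next-∷ (shift y (I ++ J) M) (>⇒∉ y<H)
      (rest-satisfied (sorted-below (I ++ J) s) y<H a≤y
        -- `rise` carries no argument for the length of `J`, so it is recovered from the total `r`.
        (resize (cong (λ j → turn r (length I) j (length M)) (sym (m∸n≡o total)))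
          (enumeration-turn r [] I J M (++-assoc I J M) s′ len′ I<b b≤J b≤M))
        (enumeration-rise r I J [] M refl s′ len′ I<b b≤J [] b≤M [] a≤M))
      (enumeration-rise (suc r) I (J ∷ʳ y) [] M (∷ʳ-assoc I J y M) s len
        I<b (All.∷ʳ⁺ b≤J b≤y) [] b≤M [] a≤M)
    where
    y<H  = sorted-above (I ++ J) s
    s′   = sorted-delete (I ++ J) s
    len′ = length-delete (I ++ J) len
    total : length J + (length I + length M) ≡ r
    total = begin
      length J + (length I + length M)  ≡⟨ +-assoc (length J) (length I) (length M) ⟨
      length J + length I + length M    ≡⟨ cong (_+ length M) (+-comm (length J) (length I)) ⟩
      length I + length J + length M    ≡⟨ cong (_+ length M) (length-++ I) ⟨
      length (I ++ J) + length M        ≡⟨ length-++ (I ++ J) ⟨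
      length ((I ++ J) ++ M)            ≡⟨ len′ ⟩
      r                                 ∎
      where open ≡-Reasoning
  enumeration-rise (suc r) I J [] [] _ _ _ _ _ _ _ _ _ = next-∅ id

  -- `X` collects the skipped letters, `I` and `J` are the candidates on either side of `b`, and `K`
  -- lies above the candidates. A letter chosen from `I` is below `b`, so its run has to rise; for
  -- one chosen from `J` the overlap condition holds at once.
  enumeration-turn : ∀ r {b} X I J K {R} → R ≡ X ++ I ++ J ++ K → Sorted R → length R ≡ r →
    All (_< b) I → All (b ≤_) J → All (b ≤_) K →
    Enumeration (Next (R ≡ []) (λ y → Overlapping b y y) (I ++ J) R)
      (turn r (length I) (length J) (length K))
  enumeration-turn zero X I J K _ _ len _ _ _ = next-done len
  enumeration-turn (suc r) {b} X (y ∷ I) J K refl s len (y<b ∷ I<b) b≤J b≤K =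
    next-∷ (shift y X (I ++ J ++ K))
      (>⇒∉ (All.++⁻ˡ (I ++ J) (subst (All (y <_)) (sym (++-assoc I J K)) y<H)))
      (rest-unsatisfied (sorted-below X s) y<H y<b
        (resize
          (cong₂ (λ x m → rise r x m (length I))
            (sym (m∸n≡o (length-++₄ X I J K len′))) (length-++ J))
        (enumeration-rise r X [] I (J ++ K) (cong (_++ I ++ J ++ K) (sym (++-identityʳ X)))
          (sorted-delete X s) len′
          (sorted-below X s) [] (All.++⁻ˡ I y≤H) (All.++⁻ʳ I y≤H) I<b (All.++⁺ b≤J b≤K))))
      (enumeration-turn (suc r) (X ∷ʳ y) I J K (sym (∷ʳ-++ X y (I ++ J ++ K))) s len I<b b≤J b≤K)
    where
    y<H  = sorted-above X s
    y≤H  = All.map <⇒≤ y<H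
    len′ = length-delete X len
  enumeration-turn (suc r) {b} X [] (y ∷ J) K refl s len [] (b≤y ∷ b≤J) b≤K =
    next-∷ (shift y X (J ++ K)) (>⇒∉ (All.++⁻ˡ J y<H))
      (rest-satisfied (sorted-below X s) y<H b≤y
        (resize (cong₂ (λ x m → turn r x 0 m) |X| (length-++ J))
          (subst
            (λ L → Enumeration (Next (R ≡ []) (λ z → Overlapping y z z) L R)
                     (turn r (length X) 0 (length (J ++ K))))
            (++-identityʳ X)
            (enumeration-turn r [] X [] (J ++ K) refl s′ len′ X<y [] y≤H)))
        (resize (cong₂ (λ x m → rise r x m 0) |X| (length-++ J))
        (enumeration-rise r X [] [] (J ++ K) (cong (_++ J ++ K) (sym (++-identityʳ X))) s′ len′
          X<y [] [] y≤H [] (All.++⁺ b≤J b≤K))))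
      (enumeration-turn (suc r) (X ∷ʳ y) [] J K (sym (∷ʳ-++ X y (J ++ K))) s len [] b≤J b≤K)
    where
    R    = X ++ J ++ K
    X<y  = sorted-below X s
    y<H  = sorted-above X s
    y≤H  = All.map <⇒≤ y<H
    s′   = sorted-delete X s
    len′ = length-delete X len
    |X|  = sym (m∸n≡o (length-++₄ X [] J K len′))
  enumeration-turn (suc r) X [] [] K _ _ len _ _ _ = next-∅ λ { refl → case len of λ () }

[1…]-sorted : ∀ n → Sorted [1… n ]
[1…]-sorted n = AllPairs.applyUpTo⁺₁ suc n (λ i<j _ → s<s i<j)

-- The word starts as if a run with first letter 0 had just ended: all letters are candidates in
-- `J`, and the first run has nothing to exceed.
enumeration-f : ∀ n → Enumeration (PopStacked (suc n)) (turn (suc n) 0 (suc n) 0)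
enumeration-f n = enumeration-⇔ (λ _ → mk⇔ to from)
  (subst (λ l → Enumeration (Next (R ≡ []) (λ y → Overlapping 0 y y) R R) (turn (suc n) 0 l 0)) len
    (enumeration-turn (suc n) [] [] R [] (sym (++-identityʳ R)) ([1…]-sorted (suc n)) len
      [] (All.universal (λ _ → z≤n) R) []))
  where
  R   = [1… suc n ]
  len = length-applyUpTo suc (suc n)
  to : ∀ {σ} → Next (R ≡ []) (λ y → Overlapping 0 y y) R R σ → PopStacked (suc n) σ
  to (next _ o p) with π , eq ← overlapping-P (start o) =
    -- The preimage is a permutation of the same letters because `P` only rearranges.
    p , π , ↭-trans (↭-sym (P-↭ π)) (↭-trans (↭-reflexive (sym eq)) p) , eq
  from : ∀ {σ} → PopStacked (suc n) σ → Next (R ≡ []) (λ y → Overlapping 0 y y) R R σ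
  from (_ , []    , π↭R , _)    = contradiction (↭-sym π↭R) ¬x∷xs↭[]
  from (σ↭R , x ∷ π , _ , refl) with P (x ∷ π) | P-overlapping x π
  ... | _ | start o = next (∈-resp-↭ σ↭R (here refl)) o σ↭R

f-recurrence : ∀ n → f (suc n) ≡ turn (suc n) 0 (suc n) 0
f-recurrence n = enumeration-size
  (record { words = popStacked (suc n) ; unique = popStacked-unique (suc n)
          ; complete = ∈-popStacked (suc n) ; size = refl })
  (enumeration-f n)

-- Program logic

open State

-- A total-correctness triple with a time bound. `T` is only an upper bound, so branches and rounds
-- of different cost can share it.
record Halts {k m} (s : State k m) (p : Program k) (Q : State k m → Set) (T : ℕ) : Set where
  constructor halts
  field
    {final}     : State k m
    {time}      : ℕ
    computation : s ⊢ p ⇓ final [ time ]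
    correct     : Q final
    time≤       : time ≤ T

set : ∀ {k m} → Fin k → ℤ → State k m → State k m
set r z ⟨ ρ , μ , o ⟩ = ⟨ ρ [ r ↦ z ] , μ , o ⟩

positive : ∀ {k} → Expr k → Test k
positive e = lit (+ 1) ≤? e

record Evaluates {k} (ρ : Vector ℤ k) (e : Expr k) (n : ℕ) : Set where
  constructor evaluates
  field value : eval ρ e ≡ + n

open Evaluates

module _ {k m : ℕ} where

  private variable
    s : State k m
    p q : Program k
    Q R : State k m → Set
    T U : ℕ
    r : Fin k
    d e : Expr k

  consequence : (∀ {s′} → Q s′ → R s′) → T ≤ U → Halts s p Q T → Halts s p R U
  consequence Q⇒R T≤U (halts c q t≤T) = halts c (Q⇒R q) (≤-trans t≤T T≤U)

  skip-rule : Q s → Halts s skip Q 1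
  skip-rule q = halts ⇓skip q ≤-refl

  assign-rule : Q (set r (eval (registers s) e) s) → Halts s (r ≔ e) Q (suc (cost e))
  assign-rule q = halts ⇓assign q ≤-refl

  store-rule : (a : Fin m) → Evaluates (registers s) d (toℕ a) →
               Q ⟨ registers s , (memory s) [ a ↦ eval (registers s) e ] , outputs s ⟩ →
               Halts s (mem[ d ]≔ e) Q (suc (cost d + cost e))
  store-rule a eq q = halts (⇓store a (value eq)) q ≤-refl

  assign-then : Halts (set r (eval (registers s) e) s) q Q T →
                Halts s (r ≔ e ⨾ q) Q (suc (cost e) + T)
  assign-then (halts c q t≤T) = halts (⇓seq ⇓assign c) q (+-monoʳ-≤ _ t≤T)

  load-then : (a : Fin m) → Evaluates (registers s) e (toℕ a) → Halts (set r (memory s a) s) q Q T →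
              Halts s (r ≔mem[ e ] ⨾ q) Q (suc (cost e) + T)
  load-then a eq (halts c q t≤T) = halts (⇓seq (⇓load a (value eq)) c) q (+-monoʳ-≤ _ t≤T)

  output-then : Halts ⟨ registers s , memory s , outputs s ∷ʳ eval (registers s) e ⟩ q Q T →
                Halts s (output e ⨾ q) Q (suc (cost e) + T)
  output-then (halts c q t≤T) = halts (⇓seq ⇓output c) q (+-monoʳ-≤ _ t≤T)

  seq-rule : Halts s p Q T → (∀ {s′} → Q s′ → Halts s′ q R U) → Halts s (p ⨾ q) R (T + U)
  seq-rule (halts c q t≤T) h with halts c′ r u≤U ← h q = halts (⇓seq c c′) r (+-mono-≤ t≤T u≤U)

  -- The sum of the branch bounds replaces their maximum, which keeps all bounds polynomial
  -- expressions.
  test-rule : ∀ n → Evaluates (registers s) e n →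
              (∀ {n′} → n ≡ suc n′ → Halts s p Q T) → (n ≡ 0 → Halts s q Q U) →
              Halts s (test positive e then p else q) Q (testCost (positive e) + (T + U))
  test-rule {T = T} {U = U} zero (evaluates eq) _ h with halts c q t≤U ← h refl =
    halts (⇓else (subst (ℤ._< + 1) (sym eq) (ℤ.+<+ z<s)) c) q (+-monoʳ-≤ _ (≤-trans t≤U (m≤n+m U T)))
  test-rule {T = T} {U = U} (suc n) (evaluates eq) h _ with halts c q t≤T ← h refl =
    halts (⇓then (subst (+ 1 ℤ.≤_) (sym eq) (ℤ.+≤+ (s≤s z≤n))) c) q
      (+-monoʳ-≤ _ (≤-trans t≤T (m≤m+n T U)))

-- Counting loops

successor : ∀ {k} → Fin k → Expr k
successor i = lit (+ 1) ⊕ reg i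

while-below for-below : ∀ {k} → Fin k → Expr k → Program k → Program k
while-below i e p = while successor i ≤? e loop (p ⨾ i ≔ successor i)
for-below i e p = i ≔ lit 0ℤ ⨾ while-below i e p

opaque
  -- The 2 pays for resetting the counter. The factor is `suc n` because the final failing test is
  -- charged as a full round.
  forTime : ℕ → ℕ → ℕ → ℕ
  forTime κ n T = 2 + suc n * (κ + T)

module _ {k m} {i : Fin k} {e : Expr k} {p : Program k} {n T : ℕ} (Inv : ℕ → State k m → Set)
  (counter : ∀ {x s} → Inv x s → registers s i ≡ + x × eval (registers s) e ≡ + n)
  (body : ∀ {x s} → x < n → Inv x s →
          Halts s p (λ s′ → Inv (suc x) (set i (eval (registers s′) (successor i)) s′)) T)
  where

  private
    step : ℕ
    step = 8 + cost e + T

  -- Induction on the number `d` of rounds left. In `step`, the test costs `4 + cost e` and the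
  -- increment 4.
  while-below-rule : ∀ d {x s} → x + d ≡ n → Inv x s →
                     Halts s (while-below i e p) (Inv n) (suc d * step)
  while-below-rule zero {x} {s} x≡n inv
    with refl ← trans (sym (+-identityʳ x)) x≡n | i≡ , e≡ ← counter inv =
    halts (⇓stop fails) inv
      (≤-trans (m≤m+n (4 + cost e) (4 + T)) (≤-reflexive (lemma (cost e) T)))
    where
    fails : Fails (registers s) (successor i ≤? e)
    fails rewrite i≡ | e≡ = ℤ.+<+ (n<1+n _)
    lemma : ∀ c t → 4 + c + (4 + t) ≡ 1 * (8 + c + t)
    lemma = solve-∀
  while-below-rule (suc d) {x} {s} x+d≡n inv
    with i≡ , e≡ ← counter inv
    with x<n ← subst (x <_) x+d≡n (m<m+n x z<s)
    with halts {time = t} c inv′ t≤T ← body x<n inv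
    with halts {time = t′} c′ inv″ t′≤ ← while-below-rule d (trans (sym (+-suc x d)) x+d≡n) inv′ =
    halts (⇓loop holds (⇓seq c ⇓assign) c′) inv″
      (≤-trans (≤-reflexive (lemma (cost e) t t′)) (+-mono-≤ (+-monoʳ-≤ (8 + cost e) t≤T) t′≤))
    where
    holds : Holds (registers s) (successor i ≤? e)
    holds rewrite i≡ | e≡ = ℤ.+≤+ x<n
    lemma : ∀ c t t′ → 4 + c + (t + 4 + t′) ≡ 8 + c + t + t′
    lemma = solve-∀

  opaque
    unfolding forTime

    for-below-rule : ∀ {s} → Inv 0 (set i 0ℤ s) →
                     Halts s (for-below i e p) (Inv n) (forTime (8 + cost e) n T)
    for-below-rule inv = seq-rule (assign-rule inv) (while-below-rule n refl)

-- The loops are controlled by the first six registers; acc and tmp are scratch registers.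
input level i₁ i₂ i₃ phase acc tmp : Fin 8
input = 0F
level = 1F
i₁    = 2F
i₂    = 3F
i₃    = 4F
phase = 5F
acc   = 6F
tmp   = 7F

gather : List (Expr 8) → Program 8
gather []       = skip
gather (e ∷ es) = tmp ≔mem[ e ] ⨾ acc ≔ reg acc ⊕ reg tmp ⨾ gather es

gatherTime : List (Expr 8) → ℕ
gatherTime []       = 1
gatherTime (e ∷ es) = suc (cost e) + (4 + gatherTime es)

-- `gather` overwrites `acc` and `tmp` between its loads, so its later addresses must be insensitive
-- to both.
IgnoresScratch : Expr 8 → Set
IgnoresScratch e = ∀ ρ (i : Fin 2) x → eval (ρ [ 6 ↑ʳ i ↦ x ]) e ≡ eval ρ e

data Loads {m} (ρ : Vector ℤ 8) (μ : Vector ℤ m) : List (Expr 8) → List ℕ → Set where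
  []   : Loads ρ μ [] []
  load : ∀ {e z es zs} → IgnoresScratch e → (a : Fin m) → Evaluates ρ e (toℕ a) → μ a ≡ + z →
         Loads ρ μ es zs → Loads ρ μ (e ∷ es) (z ∷ zs)

loads-scratch : ∀ {m ρ} {μ : Vector ℤ m} {es zs} i x → Loads ρ μ es zs → Loads (ρ [ 6 ↑ʳ i ↦ x ]) μ es zs
loads-scratch i x []                   = []
loads-scratch i x (load ig a eq v ls) =
  load ig a (evaluates (trans (ig _ i x) (value eq))) v (loads-scratch i x ls)

record Computes {m} (s : State 8 m) (z : ℕ) (s′ : State 8 m) : Set where
  constructor computes
  field
    preserved : ∀ (r : Fin 6) → registers s′ (r ↑ˡ 2) ≡ registers s (r ↑ˡ 2)
    memory≡   : memory s′ ≡ memory s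
    outputs≡  : outputs s′ ≡ outputs s
    acc≡      : registers s′ acc ≡ + z

scratch : ∀ (ρ : Vector ℤ 8) i x (r : Fin 6) → (ρ [ 6 ↑ʳ i ↦ x ]) (r ↑ˡ 2) ≡ ρ (r ↑ˡ 2)
scratch ρ i x 0F = refl
scratch ρ i x 1F = refl
scratch ρ i x 2F = refl
scratch ρ i x 3F = refl
scratch ρ i x 4F = refl
scratch ρ i x 5F = refl

computes-scratch : ∀ {m} {s s′ : State 8 m} {z} i x → Computes (set (6 ↑ʳ i) x s) z s′ → Computes s z s′
computes-scratch {s = s} i x (computes pr m o z) =
  computes (λ r → trans (pr r) (scratch (registers s) i x r)) m o z

gather-rule : ∀ {m} {s : State 8 m} {es zs v} → registers s acc ≡ + v →
              Loads (registers s) (memory s) es zs →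
              Halts s (gather es) (Computes s (foldl _+_ v zs)) (gatherTime es)
gather-rule acc≡ [] = skip-rule (computes (λ _ → refl) refl refl acc≡)
gather-rule {s = s} acc≡ (load _ a eq v ls) =
  load-then a eq (assign-then (consequence
    (computes-scratch 1F _ ∘ computes-scratch 0F _) ≤-refl
    (gather-rule (cong₂ ℤ._+_ acc≡ v) (loads-scratch 0F _ (loads-scratch 1F _ ls)))))

choose : Fin 6 → List (Expr 8) → Fin 6 → List (Expr 8) → Program 8
choose i es j es′ =
  -- This 0 is the result when neither index is positive.
  acc ≔ lit 0ℤ ⨾
  test positive (reg (i ↑ˡ 2)) then gather es else
  test positive (reg (j ↑ˡ 2)) then gather es′ else skip

chooseTime : List (Expr 8) → List (Expr 8) → ℕ
chooseTime es es′ = 2 + (3 + (gatherTime es + (3 + (gatherTime es′ + 1))))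

-- A left fold from 0 reduces to the left-nested sums in the clauses of `rise` and `turn`, so the
-- equations needed later hold by `refl`.
Sums : ∀ {m} → State 8 m → List (Expr 8) → ℕ → Set
Sums s es z = ∃[ zs ] Loads (registers s) (memory s) es zs × foldl _+_ 0 zs ≡ z

choose-rule : ∀ {l} {s : State 8 l} {i es j es′ z} m n →
  registers s (i ↑ˡ 2) ≡ + m → registers s (j ↑ˡ 2) ≡ + n →
  (∀ {m′} → m ≡ suc m′ → Sums s es z) →
  (∀ {n′} → m ≡ 0 → n ≡ suc n′ → Sums s es′ z) →
  (m ≡ 0 → n ≡ 0 → 0 ≡ z) →
  Halts s (choose i es j es′) (Computes s z) (chooseTime es es′)
choose-rule {s = s} {i} {j = j} m n i≡ j≡ first second neither =
  assign-then (consequence (computes-scratch 0F 0ℤ) ≤-refl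
    (test-rule m (evaluates (trans (scratch _ 0F 0ℤ i) i≡)) (λ m≡ → sums (first m≡)) λ m≡ →
     test-rule n (evaluates (trans (scratch _ 0F 0ℤ j) j≡)) (λ n≡ → sums (second m≡ n≡)) λ n≡ →
     skip-rule (computes (λ _ → refl) refl refl (cong +_ (neither m≡ n≡)))))
  where
  sums : ∀ {es z} → Sums s es z →
         Halts (set acc 0ℤ s) (gather es) (Computes (set acc 0ℤ s) z) (gatherTime es)
  sums (_ , ls , refl) = gather-rule refl (loads-scratch 0F 0ℤ ls)

-- The program

-- A cell address is written in mixed radix: buffer q, table τ, then three indices below N + 1.
side : Expr 8
side = successor input

digit : Expr 8 → Expr 8 → Expr 8 → Expr 8
digit n x y = n ⊗ x ⊕ y

cellAt : Expr 8 → ℤ → Expr 8 → Expr 8 → Expr 8 → Expr 8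
cellAt q τ a b c =
  digit side (digit side (digit side (digit (lit (+ 2)) q (lit τ)) a) b) c

-- `phase` names the buffer of the finished level; the other buffer is being filled.
current : Expr 8
current = lit (+ 1) ⊖ reg phase

riseLast turnLast riseCur turnCur : Expr 8 → Expr 8 → Expr 8 → Expr 8
riseLast = cellAt (reg phase) (+ 0)
turnLast = cellAt (reg phase) (+ 1)
riseCur  = cellAt current (+ 0)
turnCur  = cellAt current (+ 1)

zero′ : Expr 8
zero′ = lit 0ℤ

pred′ : Expr 8 → Expr 8
pred′ e = e ⊖ lit (+ 1)

-- The summands of the clauses of rise and turn, as addresses.
riseExt riseNew turnLow turnHigh : List (Expr 8)
riseExt  = riseLast (reg i₁) (reg i₂) (pred′ (reg i₃)) ∷ riseCur (reg i₁) (reg i₂) (pred′ (reg i₃)) ∷ []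
riseNew  = turnLast (reg i₁) (reg level ⊖ (reg i₁ ⊕ pred′ (reg i₂))) (pred′ (reg i₂))
         ∷ riseLast (reg i₁) (pred′ (reg i₂)) zero′
         ∷ riseCur (reg i₁) (pred′ (reg i₂)) zero′ ∷ []
turnLow  = riseLast (reg level ⊖ (pred′ (reg i₁) ⊕ (reg i₂ ⊕ reg i₃))) (reg i₂ ⊕ reg i₃) (pred′ (reg i₁))
         ∷ turnCur (pred′ (reg i₁)) (reg i₂) (reg i₃) ∷ []
turnHigh = turnLast (reg level ⊖ (pred′ (reg i₂) ⊕ reg i₃)) zero′ (pred′ (reg i₂) ⊕ reg i₃)
         ∷ riseLast (reg level ⊖ (pred′ (reg i₂) ⊕ reg i₃)) (pred′ (reg i₂) ⊕ reg i₃) zero′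
         ∷ turnCur zero′ (pred′ (reg i₂)) (reg i₃) ∷ []

computeRise computeTurn cellBody : Program 8
computeRise = choose 4F riseExt 3F riseNew
computeTurn = choose 2F turnLow 3F turnHigh
cellBody =
  computeRise ⨾ mem[ riseCur (reg i₁) (reg i₂) (reg i₃) ]≔ reg acc ⨾
  computeTurn ⨾ mem[ turnCur (reg i₁) (reg i₂) (reg i₃) ]≔ reg acc

-- The register `level` holds `t` while level `t + 1` is filled, so the indices run over all
-- `a + b + c ≤ t + 1`.
bound₁ bound₂ bound₃ : Expr 8
bound₁ = lit (+ 2) ⊕ reg level
bound₂ = bound₁ ⊖ reg i₁
bound₃ = bound₁ ⊖ (reg i₁ ⊕ reg i₂)

loop₃ loop₂ loop₁ levelBody program : Program 8
loop₃ = for-below i₃ bound₃ cellBody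
loop₂ = for-below i₂ bound₂ loop₃
loop₁ = for-below i₁ bound₁ loop₂
levelBody =
  -- The cell read is `turn (t + 1) 0 (t + 1) 0`, which is `f (t + 1)`; afterwards the buffers
  -- change roles.
  loop₁ ⨾ acc ≔mem[ turnCur zero′ (successor level) zero′ ] ⨾ output (reg acc) ⨾ phase ≔ current
program =
  -- On its simplex, level 0 agrees with the zero memory except for `turn 0 0 0 0 = 1`.
  mem[ turnLast zero′ zero′ zero′ ]≔ lit (+ 1) ⨾ for-below level (reg input) levelBody

-- Evaluation of address expressions

eval-lit : ∀ {ρ : Vector ℤ 8} n → Evaluates ρ (lit (+ n)) n
eval-lit n = evaluates refl

eval-reg : ∀ {ρ : Vector ℤ 8} r {n} → ρ r ≡ + n → Evaluates ρ (reg r) n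
eval-reg r eq = evaluates eq

eval-⊕ : ∀ {ρ : Vector ℤ 8} {d e m n} → Evaluates ρ d m → Evaluates ρ e n → Evaluates ρ (d ⊕ e) (m + n)
eval-⊕ d≡ e≡ = evaluates (cong₂ ℤ._+_ (value d≡) (value e≡))

eval-⊖ : ∀ {ρ : Vector ℤ 8} {d e m n} → Evaluates ρ d m → Evaluates ρ e n → n ≤ m →
         Evaluates ρ (d ⊖ e) (m ∸ n)
eval-⊖ {m = m} {n} d≡ e≡ n≤m = evaluates
  (trans (cong₂ ℤ._-_ (value d≡) (value e≡)) (trans (ℤ.m-n≡m⊖n m n) (ℤ.⊖-≥ n≤m)))

eval-⊗ : ∀ {ρ : Vector ℤ 8} {d e m n} → Evaluates ρ d m → Evaluates ρ e n → Evaluates ρ (d ⊗ e) (m * n)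
eval-⊗ {m = m} {n} d≡ e≡ = evaluates
  (trans (cong₂ ℤ._*_ (value d≡) (value e≡)) (sym (ℤ.pos-* m n)))

eval-digit : ∀ {m n} {ρ : Vector ℤ 8} {d x y} (i : Fin m) (j : Fin n) →
             Evaluates ρ d n → Evaluates ρ x (toℕ i) → Evaluates ρ y (toℕ j) →
             Evaluates ρ (digit d x y) (toℕ (combine i j))
eval-digit i j d≡ x≡ y≡ =
  subst (Evaluates _ _) (sym (Fin.toℕ-combine i j)) (eval-⊕ (eval-⊗ d≡ x≡) y≡)

-- Index regions and tables in memory

Region : Set₁
Region = ℕ → ℕ → ℕ → Set

Simplex : ℕ → Region
Simplex r a b c = a + (b + c) ≤ r

-- The lexicographic order, in which the loops visit the cells.
Before : ℕ → ℕ → ℕ → Region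
Before a b c a′ b′ c′ = a′ < a ⊎ (a′ ≡ a × (b′ < b ⊎ (b′ ≡ b × c′ < c)))

SimplexBefore : ℕ → ℕ → ℕ → ℕ → Region
SimplexBefore r a b c a′ b′ c′ = Simplex r a′ b′ c′ × Before a b c a′ b′ c′

buffer : ℕ → Fin 2
buffer zero    = 0F
buffer (suc t) = opposite (buffer t)

opposite≢ : ∀ (i : Fin 2) → i ≢ opposite i
opposite≢ 0F ()
opposite≢ 1F ()

eval-opposite : ∀ {ρ : Vector ℤ 8} {e} (i : Fin 2) → Evaluates ρ e (toℕ i) →
                Evaluates ρ (lit (+ 1) ⊖ e) (toℕ (opposite i))
eval-opposite 0F e≡ = eval-⊖ (eval-lit 1) e≡ z≤n
eval-opposite 1F e≡ = eval-⊖ (eval-lit 1) e≡ (s≤s z≤n)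

module _ (N : ℕ) where

  Index : Set
  Index = Fin (suc N)

  cellCount : ℕ
  cellCount = 2 * 2 * suc N * suc N * suc N

  cell : Fin 2 → Fin 2 → Index → Index → Index → Fin cellCount
  cell q τ a b c = combine (combine (combine (combine q τ) a) b) c

  cell-injective : ∀ {q τ a b c q′ τ′ a′ b′ c′} → cell q τ a b c ≡ cell q′ τ′ a′ b′ c′ →
                   (q ≡ q′ × τ ≡ τ′) × a ≡ a′ × b ≡ b′ × c ≡ c′
  cell-injective {q} {τ} {a} {b} {c} {q′} {τ′} {a′} {b′} {c′} eq
    with eq , c≡ ← Fin.combine-injective (combine (combine (combine q τ) a) b) c _ c′ eq
    with eq , b≡ ← Fin.combine-injective (combine (combine q τ) a) b _ b′ eq
    with eq , a≡ ← Fin.combine-injective (combine q τ) a (combine q′ τ′) a′ eq =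
    Fin.combine-injective q τ q′ τ′ eq , a≡ , b≡ , c≡

  eval-cellAt : ∀ {ρ q τ a b c} (q′ τ′ : Fin 2) (a′ b′ c′ : Index) →
    Evaluates ρ (reg input) N → Evaluates ρ q (toℕ q′) → Evaluates ρ (lit τ) (toℕ τ′) →
    Evaluates ρ a (toℕ a′) → Evaluates ρ b (toℕ b′) → Evaluates ρ c (toℕ c′) →
    Evaluates ρ (cellAt q τ a b c) (toℕ (cell q′ τ′ a′ b′ c′))
  eval-cellAt q′ τ′ a′ b′ c′ N≡ q≡ τ≡ a≡ b≡ c≡ =
    eval-digit _ c′ side≡ (eval-digit _ b′ side≡ (eval-digit _ a′ side≡
      (eval-digit q′ τ′ (eval-lit 2) q≡ τ≡) a≡) b≡) c≡
    where side≡ = eval-⊕ (eval-lit 1) N≡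

  Memory : Set
  Memory = Vector ℤ cellCount

  record Table (μ : Memory) (q τ : Fin 2) (g : ℕ → ℕ → ℕ → ℕ) (D : Region) : Set where
    constructor table
    field entry : ∀ (a b c : Index) → D (toℕ a) (toℕ b) (toℕ c) →
                  μ (cell q τ a b c) ≡ + g (toℕ a) (toℕ b) (toℕ c)

  table-⊆ : ∀ {μ q τ g D E} → (∀ {a b c} → E a b c → D a b c) → Table μ q τ g D → Table μ q τ g E
  table-⊆ E⊆D (table T) = table λ a b c E → T a b c (E⊆D E)

  table-other : ∀ {μ q τ g D z} q′ τ′ a b c → ¬ (q ≡ q′ × τ ≡ τ′) → Table μ q τ g D →
                Table (μ [ cell q′ τ′ a b c ↦ z ]) q τ g D
  table-other {μ} {q} {τ} q′ τ′ a b c ≢ (table T) = table λ a′ b′ c′ D → trans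
    (Vector.updateAt-minimal _ _ μ
      (≢ ∘ proj₁ ∘ cell-injective {q} {τ} {a′} {b′} {c′} {q′} {τ′} {a} {b} {c}))
    (T a′ b′ c′ D)

  table-store : ∀ {μ q τ g D E z} a b c → z ≡ + g (toℕ a) (toℕ b) (toℕ c) →
    (∀ {a′ b′ c′} → E a′ b′ c′ → D a′ b′ c′ ⊎ (a′ ≡ toℕ a × b′ ≡ toℕ b × c′ ≡ toℕ c)) →
    Table μ q τ g D →
    Table (μ [ cell q τ a b c ↦ z ]) q τ g E
  table-store {μ} {q} {τ} {g} {E = E} {z} a b c z≡ E⊆ (table T) = table stored
    where
    stored : ∀ a′ b′ c′ → E (toℕ a′) (toℕ b′) (toℕ c′) →
             (μ [ cell q τ a b c ↦ z ]) (cell q τ a′ b′ c′) ≡ + g (toℕ a′) (toℕ b′) (toℕ c′)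
    stored a′ b′ c′ Ea′ with cell q τ a′ b′ c′ Fin.≟ cell q τ a b c
    ... | yes eq
      with _ , refl , refl , refl ← cell-injective {q} {τ} {a′} {b′} {c′} {q} {τ} {a} {b} {c} eq =
            trans (Vector.updateAt-updates (cell q τ a b c) μ) z≡
    ... | no  ≢ with E⊆ Ea′
    ...   | inj₁ Da′ = trans (Vector.updateAt-minimal _ _ μ ≢) (T a′ b′ c′ Da′)
    ...   | inj₂ (a≡ , b≡ , c≡) = contradiction
            (cong₂ (λ (a , b) → cell q τ a b)
              (cong₂ _,_ (Fin.toℕ-injective a≡) (Fin.toℕ-injective b≡)) (Fin.toℕ-injective c≡)) ≢

  -- A sum of at most `N` bounds each index by `N`, so each is a valid digit.
  locate : ∀ {ρ qe τe ae be ce a b c} (q τ : Fin 2) →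
    Evaluates ρ (reg input) N → Evaluates ρ qe (toℕ q) → Evaluates ρ (lit τe) (toℕ τ) →
    Evaluates ρ ae a → Evaluates ρ be b → Evaluates ρ ce c → a + (b + c) ≤ N →
    ∃[ a′ ] ∃[ b′ ] ∃[ c′ ] toℕ a′ ≡ a × toℕ b′ ≡ b × toℕ c′ ≡ c ×
      Evaluates ρ (cellAt qe τe ae be ce) (toℕ (cell q τ a′ b′ c′))
  locate {ρ} {a = a} {b} {c} q τ N≡ q≡ τ≡ a≡ b≡ c≡ ≤N =
    _ , _ , _ , Fin.toℕ-fromℕ< a< , Fin.toℕ-fromℕ< b< , Fin.toℕ-fromℕ< c< ,
    eval-cellAt q τ _ _ _ N≡ q≡ τ≡ (at a< a≡) (at b< b≡) (at c< c≡)
    where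
    a< : a < suc N
    a< = s≤s (≤-trans (m≤m+n a (b + c)) ≤N)
    b< : b < suc N
    b< = s≤s (≤-trans (≤-trans (m≤m+n b c) (m≤n+m (b + c) a)) ≤N)
    c< : c < suc N
    c< = s≤s (≤-trans (≤-trans (m≤n+m c b) (m≤n+m (b + c) a)) ≤N)
    at : ∀ {n e} (n< : n < suc N) → Evaluates ρ e n → Evaluates ρ e (toℕ (fromℕ< n<))
    at n< = subst (Evaluates ρ _) (sym (Fin.toℕ-fromℕ< n<))

  load-table : ∀ {ρ μ g D qe τe ae be ce es zs a b c} (q τ : Fin 2) → Table μ q τ g D →
    IgnoresScratch (cellAt qe τe ae be ce) →
    Evaluates ρ (reg input) N → Evaluates ρ qe (toℕ q) → Evaluates ρ (lit τe) (toℕ τ) →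
    Evaluates ρ ae a → Evaluates ρ be b → Evaluates ρ ce c →
    D a b c → a + (b + c) ≤ N → Loads ρ μ es zs →
    Loads ρ μ (cellAt qe τe ae be ce ∷ es) (g a b c ∷ zs)
  load-table q τ (table T) ig N≡ q≡ τ≡ a≡ b≡ c≡ Dabc ≤N ls
    with a , b , c , refl , refl , refl , eq ← locate q τ N≡ q≡ τ≡ a≡ b≡ c≡ ≤N =
    load ig (cell q τ a b c) eq (T a b c Dabc) ls

-- Loop bounds and the lexicographic order on the simplex

m<n∸o⇒o+m<n : ∀ {m n} o → m < n ∸ o → o + m < n
m<n∸o⇒o+m<n {m} {n} o m<n∸o = begin-strict
  o + m          <⟨ +-monoʳ-< o m<n∸o ⟩
  o + (n ∸ o)    ≡⟨ m+[n∸m]≡n (<⇒≤ (m∸n≢0⇒n<m {n} {o} λ eq → n≮0 (subst (m <_) eq m<n∸o))) ⟩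
  n              ∎
  where open ≤-Reasoning

o+m<n⇒m<n∸o : ∀ {m n} o → o + m < n → m < n ∸ o
o+m<n⇒m<n∸o {m} {n} o o+m<n = begin-strict
  m            ≡⟨ m+n∸m≡n o m ⟨
  o + m ∸ o    <⟨ ∸-monoˡ-< o+m<n (m≤m+n o m) ⟩
  n ∸ o        ∎
  where open ≤-Reasoning

simplexBefore-suc : ∀ {r a b c a′ b′ c′} → SimplexBefore r a b (suc c) a′ b′ c′ →
                    SimplexBefore r a b c a′ b′ c′ ⊎ (a′ ≡ a × b′ ≡ b × c′ ≡ c)
simplexBefore-suc (≤r , inj₁ a<)                          = inj₁ (≤r , inj₁ a<)
simplexBefore-suc (≤r , inj₂ (a≡ , inj₁ b<))              = inj₁ (≤r , inj₂ (a≡ , inj₁ b<))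
simplexBefore-suc (≤r , inj₂ (a≡ , inj₂ (b≡ , s≤s c≤))) with m≤n⇒m<n∨m≡n c≤
... | inj₁ c< = inj₁ (≤r , inj₂ (a≡ , inj₂ (b≡ , c<)))
... | inj₂ c≡ = inj₂ (a≡ , b≡ , c≡)

-- In the row of `a` and `b` the simplex only admits `c′ < suc r ∸ (a + b)`, so what precedes the
-- next row precedes the end of this one.
simplexBefore-nextRow : ∀ {r a b a′ b′ c′} → SimplexBefore r a (suc b) 0 a′ b′ c′ →
                        SimplexBefore r a b (suc r ∸ (a + b)) a′ b′ c′
simplexBefore-nextRow (≤r , inj₁ a<) = ≤r , inj₁ a<
simplexBefore-nextRow {r} {a} {b} {c′ = c′} (≤r , inj₂ (refl , inj₁ (s≤s b≤))) with m≤n⇒m<n∨m≡n b≤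
... | inj₁ b<   = ≤r , inj₂ (refl , inj₁ b<)
... | inj₂ refl = ≤r , inj₂ (refl , inj₂ (refl ,
        o+m<n⇒m<n∸o (a + b) (s≤s (subst (_≤ r) (sym (+-assoc a b c′)) ≤r))))

simplexBefore-nextPlane : ∀ {r a a′ b′ c′} → SimplexBefore r (suc a) 0 0 a′ b′ c′ →
                          SimplexBefore r a (suc r ∸ a) 0 a′ b′ c′
simplexBefore-nextPlane {a = a} {b′ = b′} {c′} (≤r , inj₁ (s≤s a≤)) with m≤n⇒m<n∨m≡n a≤
... | inj₁ a<   = ≤r , inj₁ a<
... | inj₂ refl = ≤r , inj₂ (refl , inj₁
        (o+m<n⇒m<n∸o a (s≤s (≤-trans (+-monoʳ-≤ a (m≤m+n b′ c′)) ≤r))))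
simplexBefore-nextPlane (_ , inj₂ (_ , inj₁ ()))
simplexBefore-nextPlane (_ , inj₂ (_ , inj₂ (_ , ())))

simplex⇒before : ∀ {r a b c} → Simplex r a b c → SimplexBefore r (suc r) 0 0 a b c
simplex⇒before {a = a} {b} {c} ≤r = ≤r , inj₁ (s≤s (≤-trans (m≤m+n a (b + c)) ≤r))

nothing-before : ∀ {r a b c} → ¬ SimplexBefore r 0 0 0 a b c
nothing-before (_ , inj₁ ())
nothing-before (_ , inj₂ (_ , inj₁ ()))
nothing-before (_ , inj₂ (_ , inj₂ (_ , ())))

-- Loop invariants and the computation of one cell

module _ (N : ℕ) where

  Machine : Set
  Machine = State 8 (cellCount N)

  -- The simplex suffices: every summand that the next level takes from level `t` has indices with
  -- sum at most `t`.
  record Ready (t : ℕ) (s : Machine) : Set where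
    constructor ready
    field
      input≡   : registers s input ≡ + N
      level≡   : registers s level ≡ + t
      phase≡   : registers s phase ≡ + toℕ (buffer t)
      outputs≡ : outputs s ≡ map (λ n → + f n) [1… t ]
      rises    : Table N (memory s) (buffer t) 0F (rise t) (Simplex t)
      turns    : Table N (memory s) (buffer t) 1F (turn t) (Simplex t)

  -- Level suc t is written to the buffer that held level t - 1.
  record Filling (t : ℕ) (D E : Region) (s : Machine) : Set where
    constructor filling
    field
      isReady  : Ready t s
      newRises : Table N (memory s) (opposite (buffer t)) 0F (rise (suc t)) D
      newTurns : Table N (memory s) (opposite (buffer t)) 1F (turn (suc t)) E
    open Ready isReady public

  record Cursor (a b c : ℕ) (s : Machine) : Set where
    constructor cursor
    field
      i₁≡ : registers s i₁ ≡ + a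
      i₂≡ : registers s i₂ ≡ + b
      i₃≡ : registers s i₃ ≡ + c

  ready-computes : ∀ {t s z s′} → Computes s z s′ → Ready t s → Ready t s′
  ready-computes (computes pr refl refl _) (ready N≡ t≡ q≡ o≡ R T) =
    ready (trans (pr 0F) N≡) (trans (pr 1F) t≡) (trans (pr 5F) q≡) o≡ R T

  filling-computes : ∀ {t D E s z s′} → Computes s z s′ → Filling t D E s → Filling t D E s′
  filling-computes cs@(computes _ refl _ _) (filling rd R T) = filling (ready-computes cs rd) R T

  cursor-computes : ∀ {a b c s z s′} → Computes s z s′ → Cursor a b c s → Cursor a b c s′
  cursor-computes (computes pr _ _ _) (cursor a≡ b≡ c≡) =
    cursor (trans (pr 2F) a≡) (trans (pr 3F) b≡) (trans (pr 4F) c≡)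

  ready-set : ∀ {t s} (i : Fin 3) z → Ready t s → Ready t (set (2 ↑ʳ (i ↑ˡ 3)) z s)
  ready-set 0F z (ready N≡ t≡ q≡ o≡ R T) = ready N≡ t≡ q≡ o≡ R T
  ready-set 1F z (ready N≡ t≡ q≡ o≡ R T) = ready N≡ t≡ q≡ o≡ R T
  ready-set 2F z (ready N≡ t≡ q≡ o≡ R T) = ready N≡ t≡ q≡ o≡ R T

  filling-set : ∀ {t D E s} (i : Fin 3) z → Filling t D E s →
                Filling t D E (set (2 ↑ʳ (i ↑ˡ 3)) z s)
  filling-set i z (filling rd R T) = filling (ready-set i z rd) R T

  filling-⊆ : ∀ {t D E s} → (∀ {a b c} → E a b c → D a b c) → Filling t D D s → Filling t E E s
  filling-⊆ E⊆D (filling rd R T) = filling rd (table-⊆ N E⊆D R) (table-⊆ N E⊆D T)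

  module _ {t : ℕ} (t<N : t < N) {a b c : ℕ} (abc : Simplex (suc t) a b c) where

    private
      Done : Region
      Done = SimplexBefore (suc t) a b c
      t≤N : t ≤ N
      t≤N = <⇒≤ t<N

    module _ {D E : Region} {s : Machine} (fl : Filling t D E s) (cu : Cursor a b c s) where

      open Filling fl
      open Cursor cu

      private
        q q̄ : Fin 2
        q = buffer t
        q̄ = opposite q
        ρ = registers s
        evalN : Evaluates ρ (reg input) N
        evalN = evaluates input≡
        evalT : Evaluates ρ (reg level) t
        evalT = evaluates level≡
        evalq : Evaluates ρ (reg phase) (toℕ q)
        evalq = evaluates phase≡
        evalq̄ : Evaluates ρ current (toℕ q̄)
        evalq̄ = eval-opposite q evalq
        evala : Evaluates ρ (reg i₁) a
        evala = evaluates i₁≡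
        evalb : Evaluates ρ (reg i₂) b
        evalb = evaluates i₂≡
        evalc : Evaluates ρ (reg i₃) c
        evalc = evaluates i₃≡
        eval-pred : ∀ {e n n′} → n ≡ suc n′ → Evaluates ρ e n → Evaluates ρ (pred′ e) n′
        eval-pred refl e≡ = eval-⊖ e≡ (eval-lit 1) (s≤s z≤n)
        eval0 : Evaluates ρ zero′ 0
        eval0 = eval-lit 0

      -- Each summand comes from the complete level `t`, or from level `suc t` at a
      -- lexicographically earlier index, which is already stored.
      computeRise-rule : (∀ {a′ b′ c′} → Done a′ b′ c′ → D a′ b′ c′) →
        Halts s computeRise (Computes s (rise (suc t) a b c)) (chooseTime riseExt riseNew)
      computeRise-rule Done⊆D = choose-rule c b i₃≡ i₂≡ extend new none
        where
        extend : ∀ {c′} → c ≡ suc c′ → Sums s riseExt (rise (suc t) a b c)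
        extend {c′} refl = _ ,
          load-table N q 0F rises (λ _ _ _ → refl) evalN evalq (eval-lit 0) evala evalb c′≡
            ≤t (≤-trans ≤t t≤N)
          (load-table N q̄ 0F newRises (λ _ _ _ → refl) evalN evalq̄ (eval-lit 0) evala evalb c′≡
            (Done⊆D (m≤n⇒m≤1+n ≤t , inj₂ (refl , inj₂ (refl , ≤-refl)))) (≤-trans ≤t t≤N) []) , refl
          where
          c′≡ = eval-pred refl evalc
          ≤t : a + (b + c′) ≤ t
          ≤t = s≤s⁻¹ (subst (_≤ suc t) (trans (cong (_+_ a) (+-suc b c′)) (+-suc a (b + c′))) abc)
        new : ∀ {b′} → c ≡ 0 → b ≡ suc b′ → Sums s riseNew (rise (suc t) a b c)
        new {b′} refl refl = _ ,
          load-table N q 1F turns (λ _ _ _ → refl) evalN evalq (eval-lit 1) evala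
            (eval-⊖ evalT (eval-⊕ evala b′≡) ab′≤t) b′≡ total (≤-trans total t≤N)
          (load-table N q 0F rises (λ _ _ _ → refl) evalN evalq (eval-lit 0) evala b′≡ eval0
            ≤t (≤-trans ≤t t≤N)
          (load-table N q̄ 0F newRises (λ _ _ _ → refl) evalN evalq̄ (eval-lit 0) evala b′≡ eval0
            (Done⊆D (m≤n⇒m≤1+n ≤t , inj₂ (refl , inj₁ ≤-refl))) (≤-trans ≤t t≤N) [])) , refl
          where
          b′≡ = eval-pred refl evalb
          ≤t : a + (b′ + 0) ≤ t
          ≤t = s≤s⁻¹ (subst (_≤ suc t) (+-suc a (b′ + 0)) abc)
          ab′≤t : a + b′ ≤ t
          ab′≤t = subst (λ x → a + x ≤ t) (+-identityʳ b′) ≤t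
          total : a + ((t ∸ (a + b′)) + b′) ≤ t
          total = ≤-reflexive (trans (cong (_+_ a) (+-comm (t ∸ (a + b′)) b′))
            (trans (sym (+-assoc a b′ _)) (m+[n∸m]≡n ab′≤t)))
        none : c ≡ 0 → b ≡ 0 → 0 ≡ rise (suc t) a b c
        none refl refl = refl

      -- At level `suc t` only the table of `turn` is read, so the `rise` value stored just before
      -- does not interfere.
      computeTurn-rule : (∀ {a′ b′ c′} → Done a′ b′ c′ → E a′ b′ c′) →
        Halts s computeTurn (Computes s (turn (suc t) a b c)) (chooseTime turnLow turnHigh)
      computeTurn-rule Done⊆E = choose-rule a b i₁≡ i₂≡ low high none
        where
        low : ∀ {a′} → a ≡ suc a′ → Sums s turnLow (turn (suc t) a b c)
        low {a′} refl = _ ,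
          load-table N q 0F rises (λ _ _ _ → refl) evalN evalq (eval-lit 0)
            (eval-⊖ evalT (eval-⊕ a′≡ (eval-⊕ evalb evalc)) ≤t) (eval-⊕ evalb evalc) a′≡
            total (≤-trans total t≤N)
          (load-table N q̄ 1F newTurns (λ _ _ _ → refl) evalN evalq̄ (eval-lit 1) a′≡ evalb evalc
            (Done⊆E (m≤n⇒m≤1+n ≤t , inj₁ ≤-refl)) (≤-trans ≤t t≤N) []) , refl
          where
          a′≡ = eval-pred refl evala
          ≤t : a′ + (b + c) ≤ t
          ≤t = s≤s⁻¹ abc
          total : (t ∸ (a′ + (b + c))) + ((b + c) + a′) ≤ t
          total = ≤-reflexive (trans (cong (_+_ (t ∸ (a′ + (b + c)))) (+-comm (b + c) a′)) (m∸n+n≡m ≤t))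
        high : ∀ {b′} → a ≡ 0 → b ≡ suc b′ → Sums s turnHigh (turn (suc t) a b c)
        high {b′} refl refl = _ ,
          load-table N q 1F turns (λ _ _ _ → refl) evalN evalq (eval-lit 1) x≡ eval0 rest≡
            total (≤-trans total t≤N)
          (load-table N q 0F rises (λ _ _ _ → refl) evalN evalq (eval-lit 0) x≡ rest≡ eval0
            total′ (≤-trans total′ t≤N)
          (load-table N q̄ 1F newTurns (λ _ _ _ → refl) evalN evalq̄ (eval-lit 1) eval0 b′≡ evalc
            (Done⊆E (m≤n⇒m≤1+n ≤t , inj₂ (refl , inj₁ ≤-refl))) (≤-trans ≤t t≤N) [])) , refl
          where
          b′≡ = eval-pred refl evalb
          rest≡ = eval-⊕ b′≡ evalc
          ≤t : b′ + c ≤ t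
          ≤t = s≤s⁻¹ abc
          x≡ = eval-⊖ evalT rest≡ ≤t
          total : (t ∸ (b′ + c)) + (b′ + c) ≤ t
          total = ≤-reflexive (m∸n+n≡m ≤t)
          total′ : (t ∸ (b′ + c)) + ((b′ + c) + 0) ≤ t
          total′ = subst (λ n → (t ∸ (b′ + c)) + n ≤ t) (sym (+-identityʳ (b′ + c))) total
        none : a ≡ 0 → b ≡ 0 → 0 ≡ turn (suc t) a b c
        none refl refl = refl

      locate-new : (τ : Fin 2) → ∃[ a′ ] ∃[ b′ ] ∃[ c′ ] toℕ a′ ≡ a × toℕ b′ ≡ b × toℕ c′ ≡ c ×
        Evaluates ρ (cellAt current (+ toℕ τ) (reg i₁) (reg i₂) (reg i₃)) (toℕ (cell N q̄ τ a′ b′ c′))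
      locate-new τ = locate N q̄ τ evalN evalq̄ (evaluates refl) evala evalb evalc (≤-trans abc t<N)

-- Running times and correctness of the loops

opaque
  unfolding forTime

  forTime-monoˡ : ∀ κ n n′ T → n ≤ n′ → forTime κ n T ≤ forTime κ n′ T
  forTime-monoˡ κ n n′ T n≤n′ = +-monoʳ-≤ 2 (*-monoˡ-≤ (κ + T) (s≤s n≤n′))

cellTime : ℕ
cellTime =
  chooseTime riseExt riseNew + (suc (cost (riseCur (reg i₁) (reg i₂) (reg i₃)) + 1) +
  (chooseTime turnLow turnHigh + suc (cost (turnCur (reg i₁) (reg i₂) (reg i₃)) + 1)))

-- The three inner loops are charged for the bound `suc N`, which dominates the actual ones at every
-- level.
loop₃Time loop₂Time loop₁Time levelTime programTime : ℕ → ℕ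
loop₃Time N = forTime (8 + cost bound₃) (suc N) cellTime
loop₂Time N = forTime (8 + cost bound₂) (suc N) (loop₃Time N)
loop₁Time N = forTime (8 + cost bound₁) (suc N) (loop₂Time N)
levelTime N = loop₁Time N + (suc (cost (turnCur zero′ (successor level) zero′)) + (2 + 4))
programTime N = suc (cost (turnLast zero′ zero′ zero′) + 1) + forTime 9 N (levelTime N)

-- The one point where the count of pop-stacked permutations enters the correctness of the program.
output-suc : ∀ t → map (λ n → + f n) [1… t ] ∷ʳ + turn (suc t) 0 (suc t) 0 ≡
                   map (λ n → + f n) [1… suc t ]
output-suc t = begin
  map F [1… t ] ∷ʳ + turn (suc t) 0 (suc t) 0  ≡⟨ cong (λ z → map F [1… t ] ∷ʳ + z) (f-recurrence t) ⟨
  map F [1… t ] ∷ʳ F (suc t)                   ≡⟨ map-++ F [1… t ] (suc t ∷ []) ⟨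
  map F ([1… t ] ∷ʳ suc t)                     ≡⟨ cong (map F) (applyUpTo-∷ʳ suc t) ⟩
  map F [1… suc t ]                            ∎
  where
  open ≡-Reasoning
  F = λ n → + f n

module _ (N : ℕ) {t : ℕ} (t<N : t < N) where

  private
    Done : ℕ → ℕ → ℕ → Region
    Done = SimplexBefore (suc t)

    q̄ : Fin 2
    q̄ = opposite (buffer t)

    q≢ : ∀ {A : Set} → ¬ (buffer t ≡ opposite (buffer t) × A)
    q≢ (q≡q̄ , _) = opposite≢ (buffer t) q≡q̄

  store-rise : ∀ {a b c D s} → Simplex (suc t) a b c → Filling N t (Done a b c) D s → Cursor N a b c s →
    registers s acc ≡ + rise (suc t) a b c →
    Halts s (mem[ riseCur (reg i₁) (reg i₂) (reg i₃) ]≔ reg acc)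
      (λ s′ → Filling N t (Done a b (suc c)) D s′ × Cursor N a b c s′)
      (suc (cost (riseCur (reg i₁) (reg i₂) (reg i₃)) + 1))
  store-rise abc fl@(filling (ready N≡ t≡ q≡ o≡ R T) R′ T′) cu@(cursor a≡ b≡ c≡) z≡
    with a , b , c , refl , refl , refl , eq ← locate-new N t<N abc fl cu 0F =
    store-rule (cell N q̄ 0F a b c) eq
      ( filling (ready N≡ t≡ q≡ o≡ (table-other N q̄ 0F a b c q≢ R) (table-other N q̄ 0F a b c q≢ T))
          (table-store N a b c z≡ simplexBefore-suc R′) (table-other N q̄ 0F a b c (λ ()) T′)
      , cursor a≡ b≡ c≡)

  store-turn : ∀ {a b c D s} → Simplex (suc t) a b c → Filling N t D (Done a b c) s → Cursor N a b c s →
    registers s acc ≡ + turn (suc t) a b c →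
    Halts s (mem[ turnCur (reg i₁) (reg i₂) (reg i₃) ]≔ reg acc)
      (λ s′ → Filling N t D (Done a b (suc c)) s′ × Cursor N a b c s′)
      (suc (cost (turnCur (reg i₁) (reg i₂) (reg i₃)) + 1))
  store-turn abc fl@(filling (ready N≡ t≡ q≡ o≡ R T) R′ T′) cu@(cursor a≡ b≡ c≡) z≡
    with a , b , c , refl , refl , refl , eq ← locate-new N t<N abc fl cu 1F =
    store-rule (cell N q̄ 1F a b c) eq
      ( filling (ready N≡ t≡ q≡ o≡ (table-other N q̄ 1F a b c q≢ R) (table-other N q̄ 1F a b c q≢ T))
          (table-other N q̄ 1F a b c (λ ()) R′) (table-store N a b c z≡ simplexBefore-suc T′)
      , cursor a≡ b≡ c≡)

  cellBody-rule : ∀ {a b c s} → Simplex (suc t) a b c →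
    Filling N t (Done a b c) (Done a b c) s → Cursor N a b c s →
    Halts s cellBody
      (λ s′ → Filling N t (Done a b (suc c)) (Done a b (suc c)) s′ × Cursor N a b c s′) cellTime
  cellBody-rule abc fl cu =
    seq-rule (computeRise-rule N t<N abc fl cu id) λ cs →
    seq-rule (store-rise abc (filling-computes N cs fl) (cursor-computes N cs cu) (Computes.acc≡ cs))
    λ (fl , cu) →
    seq-rule (computeTurn-rule N t<N abc fl cu id) λ cs →
    store-turn abc (filling-computes N cs fl) (cursor-computes N cs cu) (Computes.acc≡ cs)

  private
    Filled : ℕ → ℕ → ℕ → Machine N → Set
    Filled a b c = Filling N t (Done a b c) (Done a b c)

    1+t≤N : suc t + 0 ≤ N
    1+t≤N = subst (_≤ N) (sym (+-identityʳ (suc t))) t<N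

    2+t≤1+N : 2 + t ≤ suc N
    2+t≤1+N = s≤s t<N

    eval-bound₁ : ∀ {D E s} → Filling N t D E s → Evaluates (registers s) bound₁ (2 + t)
    eval-bound₁ fl = eval-⊕ (eval-lit 2) (eval-reg level (Filling.level≡ fl))

  loop₃-rule : ∀ {a b s} → a + b ≤ suc t → Filled a b 0 s → registers s i₁ ≡ + a → registers s i₂ ≡ + b →
    Halts s loop₃ (λ s′ → Filled a (suc b) 0 s′ × registers s′ i₁ ≡ + a × registers s′ i₂ ≡ + b)
      (loop₃Time N)
  loop₃-rule {a} {b} ab fl a≡ b≡ =
    consequence (λ (fl , cursor a≡ b≡ _) → filling-⊆ N simplexBefore-nextRow fl , a≡ , b≡)
      (forTime-monoˡ (8 + cost bound₃) (2 + t ∸ (a + b)) (suc N) cellTime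
        (≤-trans (m∸n≤m (2 + t) (a + b)) 2+t≤1+N))
    (for-below-rule (λ c s → Filled a b c s × Cursor N a b c s)
      (λ (fl , cursor a≡ b≡ c≡) → c≡ , value (eval-⊖ (eval-bound₁ fl)
        (eval-⊕ (eval-reg i₁ a≡) (eval-reg i₂ b≡)) (m≤n⇒m≤1+n ab)))
      (λ {c} c< (fl , cu) → consequence
        (λ (fl , cursor a≡ b≡ c≡) → filling-set N 2F _ fl , cursor a≡ b≡ (cong (ℤ._+_ (+ 1)) c≡)) ≤-refl
        (cellBody-rule (subst (_≤ suc t) (+-assoc a b c) (s≤s⁻¹ (m<n∸o⇒o+m<n (a + b) c<))) fl cu))
      (filling-set N 2F 0ℤ fl , cursor a≡ b≡ refl))

  loop₂-rule : ∀ {a s} → a ≤ suc t → Filled a 0 0 s → registers s i₁ ≡ + a →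
    Halts s loop₂ (λ s′ → Filled (suc a) 0 0 s′ × registers s′ i₁ ≡ + a) (loop₂Time N)
  loop₂-rule {a} a≤ fl a≡ =
    consequence (λ (fl , a≡ , _) → filling-⊆ N simplexBefore-nextPlane fl , a≡)
      (forTime-monoˡ (8 + cost bound₂) (2 + t ∸ a) (suc N) (loop₃Time N)
        (≤-trans (m∸n≤m (2 + t) a) 2+t≤1+N))
    (for-below-rule (λ b s → Filled a b 0 s × registers s i₁ ≡ + a × registers s i₂ ≡ + b)
      (λ (fl , a≡ , b≡) → b≡ , value (eval-⊖ (eval-bound₁ fl) (eval-reg i₁ a≡) (m≤n⇒m≤1+n a≤)))
      (λ b< (fl , a≡ , b≡) → consequence
        (λ (fl , a≡ , b≡) → filling-set N 1F _ fl , a≡ , cong (ℤ._+_ (+ 1)) b≡) ≤-refl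
        (loop₃-rule (s≤s⁻¹ (m<n∸o⇒o+m<n a b<)) fl a≡ b≡))
      (filling-set N 1F 0ℤ fl , a≡ , refl))

  loop₁-rule : ∀ {s} → Ready N t s →
    Halts s loop₁ (Filling N t (Simplex (suc t)) (Simplex (suc t))) (loop₁Time N)
  loop₁-rule rd =
    consequence (λ (fl , _) → filling-⊆ N simplex⇒before fl)
      (forTime-monoˡ (8 + cost bound₁) (2 + t) (suc N) (loop₂Time N) 2+t≤1+N)
    (for-below-rule (λ a s → Filled a 0 0 s × registers s i₁ ≡ + a)
      (λ (fl , a≡) → a≡ , value (eval-bound₁ fl))
      (λ a< (fl , a≡) → consequence
        (λ (fl , a≡) → filling-set N 0F _ fl , cong (ℤ._+_ (+ 1)) a≡) ≤-refl
        (loop₂-rule (s≤s⁻¹ a<) fl a≡))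
      -- No index precedes the origin, so at first the invariant holds whatever the buffer contains.
      (filling-set N 0F 0ℤ (filling rd (table λ _ _ _ → λ D → contradiction D nothing-before)
                                       (table λ _ _ _ → λ D → contradiction D nothing-before)) , refl))

  finish-level : ∀ {s} → Filling N t (Simplex (suc t)) (Simplex (suc t)) s →
    Halts s (acc ≔mem[ turnCur zero′ (successor level) zero′ ] ⨾ output (reg acc) ⨾ phase ≔ current)
      (λ s′ → Ready N (suc t) (set level (eval (registers s′) (successor level)) s′))
      (suc (cost (turnCur zero′ (successor level) zero′)) + (2 + 4))
  finish-level {s} (filling (ready N≡ t≡ q≡ o≡ R T) R′ (table T′))
    with a , b , c , a≡ , b≡ , c≡ , eq ← locate N {registers s} q̄ 1F (eval-reg input N≡)
           (eval-opposite (buffer t) (eval-reg phase q≡)) (eval-lit 1)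
           (eval-lit 0) (eval-⊕ (eval-lit 1) (eval-reg level t≡)) (eval-lit 0) 1+t≤N =
    load-then (cell N q̄ 1F a b c) eq (output-then (assign-rule
      -- `buffer (suc t)` is `opposite (buffer t)`, so the tables just filled are those that the
      -- next level reads.
      (ready N≡ (cong (ℤ._+_ (+ 1)) t≡)
        (value (eval-opposite (buffer t) (eval-reg {registers s} phase q≡)))
        (trans (cong₂ _∷ʳ_ o≡ result) (output-suc t)) R′ (table T′))))
    where
    value-at : ∀ {a b c x} → a ≡ 0 → b ≡ suc t → c ≡ 0 →
               (Simplex (suc t) a b c → x ≡ + turn (suc t) a b c) → x ≡ + turn (suc t) 0 (suc t) 0
    value-at refl refl refl h = h (≤-reflexive (+-identityʳ (suc t)))

    result : memory s (cell N q̄ 1F a b c) ≡ + turn (suc t) 0 (suc t) 0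
    result = value-at a≡ b≡ c≡ (T′ a b c)

  levelBody-rule : ∀ {s} → Ready N t s →
    Halts s levelBody (λ s′ → Ready N (suc t) (set level (eval (registers s′) (successor level)) s′))
      (levelTime N)
  levelBody-rule rd = seq-rule (loop₁-rule rd) finish-level

start-rule : ∀ N → Halts (initial (cellCount N) N) (mem[ turnLast zero′ zero′ zero′ ]≔ lit (+ 1))
  (λ s → Ready N 0 (set level 0ℤ s)) (suc (cost (turnLast zero′ zero′ zero′) + 1))
start-rule N = store-rule (cell N 0F 1F zero zero zero)
  (eval-cellAt N 0F 1F zero zero zero (eval-reg input refl) (eval-reg phase refl) (eval-lit 1)
    (eval-lit 0) (eval-lit 0) (eval-lit 0))
  (ready refl refl refl refl
    -- `rise 0` vanishes like the initial memory. The table of `turn` grows from the empty region by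
    -- the origin, which is all of `Simplex 0`.
    (table-other N 0F 1F zero zero zero (λ ()) (table λ _ _ _ _ → refl))
    (table-store N {D = λ _ _ _ → ⊥} zero zero zero refl (inj₂ ∘ origin) (table λ _ _ _ ())))
  where
  origin : ∀ {a b c} → Simplex 0 a b c → a ≡ 0 × b ≡ 0 × c ≡ 0
  origin {zero} {zero} {zero} _ = refl , refl , refl

opaque
  program-rule : ∀ N → Halts (initial (cellCount N) N) program
    (λ s → outputs s ≡ map (λ n → + f n) [1… N ]) (programTime N)
  program-rule N = seq-rule (start-rule N) λ rd →
    consequence Ready.outputs≡ ≤-refl
      (for-below-rule (Ready N) (λ rd → Ready.level≡ rd , Ready.input≡ rd)
        (λ t<N → levelBody-rule N t<N) rd)

-- Polynomial bounds

record BoundedBy (e : ℕ) (T : ℕ → ℕ) : Set where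
  constructor boundedBy
  field
    constant : ℕ
    bound    : ∀ N → 1 ≤ N → T N ≤ constant * N ^ e

boundedBy⇒∈O : ∀ {e T} → BoundedBy e T → T ∈O (_^ e)
boundedBy⇒∈O (boundedBy C h) = C , 1 , h

bounded-≤ : ∀ {e S T} → (∀ N → S N ≤ T N) → BoundedBy e T → BoundedBy e S
bounded-≤ S≤T (boundedBy C h) = boundedBy C λ N 1≤N → ≤-trans (S≤T N) (h N 1≤N)

-- For `N ≥ 1` a constant is absorbed into any power, so sums can be taken at a common degree.
bounded-const : ∀ K e → BoundedBy e (const K)
bounded-const K e = boundedBy K λ N 1≤N → begin
  K          ≡⟨ *-identityʳ K ⟨
  K * 1      ≡⟨ cong (_*_ K) (^-zeroˡ e) ⟨
  K * 1 ^ e  ≤⟨ *-monoʳ-≤ K (^-monoˡ-≤ e 1≤N) ⟩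
  K * N ^ e  ∎
  where open ≤-Reasoning

bounded-id : BoundedBy 1 id
bounded-id = boundedBy 1 λ N _ → ≤-reflexive (sym (trans (+-identityʳ (N ^ 1)) (*-identityʳ N)))

bounded-+ : ∀ {e S T} → BoundedBy e S → BoundedBy e T → BoundedBy e (λ N → S N + T N)
bounded-+ {e} (boundedBy C g) (boundedBy D h) = boundedBy (C + D) λ N 1≤N →
  ≤-trans (+-mono-≤ (g N 1≤N) (h N 1≤N)) (≤-reflexive (sym (*-distribʳ-+ (N ^ e) C D)))

bounded-* : ∀ {d e S T} → BoundedBy d S → BoundedBy e T → BoundedBy (d + e) (λ N → S N * T N)
bounded-* {d} {e} {S} {T} (boundedBy C g) (boundedBy D h) = boundedBy (C * D) λ N 1≤N → begin
  S N * T N                ≤⟨ *-mono-≤ (g N 1≤N) (h N 1≤N) ⟩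
  C * N ^ d * (D * N ^ e)  ≡⟨ rearrange C (N ^ d) D (N ^ e) ⟩
  C * D * (N ^ d * N ^ e)  ≡⟨ cong (_*_ (C * D)) (^-distribˡ-+-* N d e) ⟨
  C * D * N ^ (d + e)      ∎
  where
  open ≤-Reasoning
  rearrange : ∀ c x d y → c * x * (d * y) ≡ c * d * (x * y)
  rearrange = solve-∀

bounded-suc : BoundedBy 1 suc
bounded-suc = bounded-+ (bounded-const 1 1) bounded-id

opaque
  unfolding forTime

  bounded-forTime : ∀ κ {e T n} → BoundedBy 1 n → BoundedBy e T →
                    BoundedBy (suc e) (λ N → forTime κ (n N) (T N))
  bounded-forTime κ {e} n T =
    bounded-+ (bounded-const 2 (suc e))
      (bounded-* (bounded-+ (bounded-const 1 1) n) (bounded-+ (bounded-const κ e) T))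

bounded-loop₁Time : BoundedBy 3 loop₁Time
bounded-loop₁Time =
  bounded-forTime (8 + cost bound₁) bounded-suc
    (bounded-forTime (8 + cost bound₂) bounded-suc
      (bounded-forTime (8 + cost bound₃) bounded-suc (bounded-const cellTime 0)))

-- Three nested loops around a body of constant cost give degree 3; the loop over the levels adds
-- one.
bounded-programTime : BoundedBy 4 programTime
bounded-programTime =
  bounded-+ (bounded-const (suc (cost (turnLast zero′ zero′ zero′) + 1)) 4)
    (bounded-forTime 9 bounded-id
      (bounded-+ bounded-loop₁Time
        (bounded-const (suc (cost (turnCur zero′ (successor level) zero′)) + (2 + 4)) 3)))

bounded-cellCount : BoundedBy 3 (λ N → 8 + cellCount N)
bounded-cellCount =
  bounded-+ (bounded-const 8 3)
    -- The 4 counts two tables in each of two buffers.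
    (bounded-* (bounded-* (bounded-* (bounded-const 4 0) bounded-suc) bounded-suc) bounded-suc)

runningTime : ℕ → ℕ
runningTime N = Halts.time (program-rule N)

bounded-runningTime : BoundedBy 4 runningTime
bounded-runningTime = bounded-≤ (λ N → Halts.time≤ (program-rule N)) bounded-programTime

mainTheorem1 : ∃[ k ] Σ[ p ∈ Program (suc k) ] Σ[ time ∈ (ℕ → ℕ) ] Σ[ space ∈ (ℕ → ℕ) ]
    (∀ N → 1 ≤ N → Run p N (map (λ n → + f n) [1… N ]) (time N) (space N))
    × time ∈O (λ N → N ^ 4)
    × space ∈O (λ N → N ^ 3)
mainTheorem1 =
  7 , program , runningTime , (λ N → 8 + cellCount N) ,
  (λ N _ → record
    { memorySize  = cellCount N
    ; final       = Halts.final (program-rule N)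
    ; computation = Halts.computation (program-rule N)
    ; result      = Halts.correct (program-rule N)
    ; cells       = refl
    }) ,
  boundedBy⇒∈O bounded-runningTime ,
  boundedBy⇒∈O bounded-cellCount
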